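{- Let $n_3,n_4,k\in\mathbb{N}$. If $k\ge 3$, then $P_2\square P_2\square P_{n_3}\square P_{n_4}$ is equitably $k$-list arborable.
   Context: $P_n$ denotes the path on $n$ vertices and $\square$ the Cartesian product. A $k$-uniform list assignment $L$ for $G$ assigns to each vertex $v$ a set $L(v)$ of exactly $k$ colours; an $L$-colouring is a map $c$ with $c(v)\in L(v)$; it is equitable if every colour class has at most $\lceil |V(G)|/k\rceil$ vertices. $G$ is equitably $k$-list arborable if for every $k$-uniform list assignment $L$ there is an equitable $L$-colouring of $G$ in which every colour class induces an acyclic subgraph. -}

module Defs where

open import Data.Nat using (ℕ; zero; suc; _+_; _≤_; _≥_)
open import Data.Nat.DivMod using (_/_)
open import Data.Fin using (Fin; toℕ)
open import Data.Product using (_×_; _,_; ∃)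
open import Data.Sum using (_⊎_)
open import Data.List using (List; []; _∷_; _++_; [_]; length; filter; cartesianProduct; allFin)
open import Data.List.Membership.Propositional using (_∈_)
open import Data.List.Relation.Unary.All using (All)
open import Data.List.Relation.Unary.Unique.Propositional using (Unique)
open import Data.List.Relation.Unary.Linked using (Linked)
open import Relation.Binary.PropositionalEquality using (_≡_)
open import Relation.Nullary using (¬_)
import Data.Nat as N

-- A finite simple graph: vertex type, adjacency relation, and the list of all vertices
-- (each vertex exactly once).
record Graph : Set₁ where
  field
    V        : Set
    Adj      : V → V → Set
    vertices : List V
open Graph public

P : ℕ → Graph
P n = record
  { V = Fin n
  ; Adj = λ i j → (toℕ j ≡ suc (toℕ i)) ⊎ (toℕ i ≡ suc (toℕ j))
  ; vertices = allFin n
  }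

_□_ : Graph → Graph → Graph
G □ H = record
  { V = V G × V H
  ; Adj = λ { (u₁ , u₂) (v₁ , v₂) →
        (u₁ ≡ v₁ × Adj H u₂ v₂) ⊎ (Adj G u₁ v₁ × u₂ ≡ v₂) }
  ; vertices = cartesianProduct (vertices G) (vertices H)
  }
infixr 6 _□_

-- ⌈ n / k ⌉ for k ≥ 1 (value for k = 0 is irrelevant and set to 0).
⌈_/_⌉ : ℕ → ℕ → ℕ
⌈ n / zero ⌉ = 0
⌈ n / suc j ⌉ = (n + j) / suc j

IsUniformListAssignment : (G : Graph) → ℕ → (V G → List ℕ) → Set
IsUniformListAssignment G k L = ∀ v → Unique (L v) × length (L v) ≡ k

IsLColouring : (G : Graph) → (V G → List ℕ) → (V G → ℕ) → Set
IsLColouring G L c = ∀ v → c v ∈ L v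

classSize : (G : Graph) → (V G → ℕ) → ℕ → ℕ
classSize G c a = length (filter (λ v → c v N.≟ a) (vertices G))

IsEquitable : (G : Graph) → ℕ → (V G → ℕ) → Set
IsEquitable G k c = ∀ a → classSize G c a ≤ ⌈ length (vertices G) / k ⌉

IsCycle : (G : Graph) → List (V G) → Set
IsCycle G [] = Data.Empty.⊥ where import Data.Empty
IsCycle G (x ∷ xs) =
  length (x ∷ xs) ≥ 3 × Unique (x ∷ xs) × Linked (Adj G) (x ∷ xs ++ [ x ])

ClassAcyclic : (G : Graph) → (V G → ℕ) → ℕ → Set
ClassAcyclic G c a = ∀ (cyc : List (V G)) → IsCycle G cyc → ¬ All (λ v → c v ≡ a) cyc

EquitablyListArborable : Graph → ℕ → Set
EquitablyListArborable G k =
  ∀ (L : V G → List ℕ) → IsUniformListAssignment G k L →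
  ∃ λ (c : V G → ℕ) →
    IsLColouring G L c × IsEquitable G k c × (∀ a → ClassAcyclic G c a)

{-# OPTIONS --safe #-}

-- Order the vertices and cut the order into blocks of k. If, block by block, all colours within a block are
-- distinct and every vertex has at most one earlier neighbour of its colour, then every colour occurs at most
-- once per block and every colour class is a forest. A vertex with e earlier vertices in its block and m
-- earlier neighbours outside it can be coloured greedily when e + m / 2 < k, since a colour is forbidden by a
-- neighbourhood only if it occurs there twice. The n₃ n₄ copies of the 4-cycle P₂ □ P₂ are put in a linear
-- order in which a copy has at most two earlier neighbouring copies, one of which is its predecessor. Vertex
-- orders fit for the greedy colouring then exist for all k ≥ 3, unless k = 3 divides n₃ n₄: the last block is
-- then a full triple whose last vertex in general has degree 4 and so two neighbours outside the triple, which
-- may forbid the only colour left. In this case the greedy colouring is repaired by recolouring both ends of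
-- one edge of the last copy, choosing the two colours together.

module Submission where

open import Defs
open import Data.Nat hiding (_/_; _%_)
open import Data.Nat.Properties
open import Data.Nat.DivMod
open import Data.Nat.Divisibility using (divides; n∣m*n; m%n≡0⇒n∣m)
open import Data.Nat.Primality using (prime?; euclidsLemma)
open import Data.Nat.Solver using (module +-*-Solver)
open import Data.Fin as Fin using (Fin; toℕ; zero; suc; combine; opposite; fromℕ<)
open import Data.Fin.Properties
  using (toℕ-injective; toℕ<n; toℕ-fromℕ<; all?; combine-injective; combine-surjective; toℕ-combine;
         opposite-prop; opposite-involutive)
open import Data.Product using (_×_; _,_; ∃; ∃₂; proj₁; proj₂; swap)
open import Data.Sum as Sum using (_⊎_; inj₁; inj₂)
open import Data.List
  using (List; []; _∷_; _++_; [_]; length; filter; foldr; map; upTo; allFin; cartesianProduct)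
open import Data.List.Properties
  using (length-++; length-map; length-upTo; length-tabulate; filter-++; filter-accept; filter-reject)
open import Data.List.Membership.Propositional using (_∈_; _∉_; find; lose)
open import Data.List.Membership.DecPropositional _≟_ using (_∈?_)
open import Data.List.Membership.Propositional.Properties
  using (∈-∃++; ∈-++⁺ˡ; ∈-++⁺ʳ; ∈-++⁻; ∈-map⁺; ∈-map⁻; ∈-filter⁺; ∈-filter⁻; ∈-upTo⁺; ∈-allFin;
         ∈-cartesianProduct⁺)
open import Data.List.Relation.Unary.Any using (here; there; any?)
open import Data.List.Relation.Unary.All as All using (All; []; _∷_)
import Data.List.Relation.Unary.All.Properties as All
open import Data.List.Relation.Unary.AllPairs using ([]; _∷_)
open import Data.List.Relation.Unary.Linked using (Linked; _∷_)
open import Data.List.Relation.Unary.Unique.Propositional using (Unique)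
import Data.List.Relation.Unary.Unique.Propositional.Properties as Unique
open import Relation.Unary using (Decidable)
open import Relation.Nullary using (¬_; Dec; yes; no; contradiction)
open import Relation.Nullary.Decidable using (¬?; _×-dec_; _⊎-dec_; _→-dec_; toWitness)
open import Relation.Binary.Definitions using (tri<; tri≈; tri>)
open import Relation.Binary.PropositionalEquality hiding ([_])
open import Function using (_∘_)

-- Counting in lists

Unique-⊆⇒length-≤ : ∀ {A : Set} {xs ys : List A} → Unique xs → (∀ {x} → x ∈ xs → x ∈ ys) →
                    length xs ≤ length ys
Unique-⊆⇒length-≤ [] _ = z≤n
Unique-⊆⇒length-≤ {xs = x ∷ xs} (x∉ ∷ u) sub with ∈-∃++ (sub (here refl))
... | as , bs , refl = begin
  suc (length xs)             ≤⟨ s≤s (Unique-⊆⇒length-≤ u sub′) ⟩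
  suc (length (as ++ bs))     ≡⟨ cong suc (length-++ as) ⟩
  suc (length as + length bs) ≡⟨ +-suc (length as) (length bs) ⟨
  length as + suc (length bs) ≡⟨ length-++ as ⟨
  length (as ++ x ∷ bs)       ∎
  where
  open ≤-Reasoning
  sub′ : ∀ {y} → y ∈ xs → y ∈ as ++ bs
  sub′ y∈ with ∈-++⁻ as (sub (there y∈))
  ... | inj₁ y∈as         = ∈-++⁺ˡ y∈as
  ... | inj₂ (here refl)  = contradiction refl (All.lookup x∉ y∈)
  ... | inj₂ (there y∈bs) = ∈-++⁺ʳ as y∈bs

Unique-map⁺ : ∀ {A B : Set} {f : A → B} {xs} → (∀ {x y} → x ∈ xs → y ∈ xs → f x ≡ f y → x ≡ y) →
              Unique xs → Unique (map f xs)
Unique-map⁺ inj [] = []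
Unique-map⁺ inj (x∉ ∷ u) =
  All.map⁺ (All.tabulate λ y∈ eq → All.lookup x∉ y∈ (inj (here refl) (there y∈) eq)) ∷
  Unique-map⁺ (λ x∈ y∈ → inj (there x∈) (there y∈)) u

length-filter-∁ : ∀ {A : Set} {P : A → Set} (P? : Decidable P) xs →
                  length xs ≡ length (filter P? xs) + length (filter (¬? ∘ P?) xs)
length-filter-∁ P? [] = refl
length-filter-∁ P? (x ∷ xs) with P? x
... | yes _ = cong suc (length-filter-∁ P? xs)
... | no  _ = trans (cong suc (length-filter-∁ P? xs)) (sym (+-suc _ _))

count : ℕ → List ℕ → ℕ
count a xs = length (filter (_≟ a) xs)

count-++ : ∀ a xs ys → count a (xs ++ ys) ≡ count a xs + count a ys
count-++ a xs ys = trans (cong length (filter-++ (_≟ a) xs ys)) (length-++ (filter (_≟ a) xs))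

count-yes : ∀ {a x} xs → x ≡ a → count a (x ∷ xs) ≡ suc (count a xs)
count-yes {a} xs eq = cong length (filter-accept (_≟ a) eq)

count-no : ∀ {a x} xs → x ≢ a → count a (x ∷ xs) ≡ count a xs
count-no {a} xs ne = cong length (filter-reject (_≟ a) ne)

∈⇒count : ∀ {a xs} → a ∈ xs → 1 ≤ count a xs
∈⇒count {a} {xs} a∈ =
  Unique-⊆⇒length-≤ {xs = [ a ]} ([] ∷ []) λ { (here refl) → ∈-filter⁺ (_≟ a) a∈ refl }

count-filter-≢ : ∀ {a b} xs → a ≢ b → count a (filter (¬? ∘ (_≟ b)) xs) ≡ count a xs
count-filter-≢ [] ne = refl
count-filter-≢ {a} {b} (x ∷ xs) ne with x ≟ b
... | yes refl rewrite filter-reject (¬? ∘ (_≟ b)) {x} {xs} (λ ¬eq → ¬eq refl) | count-no {a} xs (ne ∘ sym) =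
  count-filter-≢ xs ne
... | no x≢b rewrite filter-accept (¬? ∘ (_≟ b)) {x} {xs} x≢b with x ≟ a
...   | yes eq rewrite count-yes xs eq | count-yes (filter (¬? ∘ (_≟ b)) xs) eq =
  cong suc (count-filter-≢ xs ne)
...   | no x≢a rewrite count-no xs x≢a | count-no (filter (¬? ∘ (_≟ b)) xs) x≢a = count-filter-≢ xs ne

count-∷-≤ : ∀ a x xs → count a xs ≤ count a (x ∷ xs)
count-∷-≤ a x xs with x ≟ a
... | yes eq = ≤-trans (n≤1+n _) (≤-reflexive (sym (count-yes xs eq)))
... | no ne  = ≤-reflexive (sym (count-no xs ne))

two-in-map : ∀ {A : Set} {f : A → ℕ} {a x y xs} → x ≢ y → x ∈ xs → y ∈ xs → f x ≡ a → f y ≡ a →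
             2 ≤ count a (map f xs)
two-in-map {xs = z ∷ zs} ne (here refl) (here refl) _ _ = contradiction refl ne
two-in-map {f = f} {xs = z ∷ zs} ne (here refl) (there y∈) refl fy
  rewrite count-yes {f z} (map f zs) refl = s≤s (subst (λ b → 1 ≤ count b (map f zs)) fy (∈⇒count (∈-map⁺ f y∈)))
two-in-map {f = f} {xs = z ∷ zs} ne (there x∈) (here refl) fx refl
  rewrite count-yes {f z} (map f zs) refl = s≤s (subst (λ b → 1 ≤ count b (map f zs)) fx (∈⇒count (∈-map⁺ f x∈)))
two-in-map {f = f} {a} {xs = z ∷ zs} ne (there x∈) (there y∈) fx fy =
  ≤-trans (two-in-map ne x∈ y∈ fx fy) (count-∷-≤ a (f z) (map f zs))

-- If every element of L occurred twice in W, then W would have at least 2 |L| entries.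
rare-element : ∀ {L W} → Unique L → length W < 2 * length L → ∃ λ y → y ∈ L × count y W ≤ 1
rare-element {y ∷ L} {W} (y∉ ∷ u) lt with count y W ≤? 1
... | yes few = y , here refl , few
... | no many =
  let (z , z∈ , few) = rare-element {L} {W′} u lt′
  in z , there z∈ , subst (_≤ 1) (count-filter-≢ W (All.lookup y∉ z∈ ∘ sym)) few
  where
  W′ = filter (¬? ∘ (_≟ y)) W
  lt′ : length W′ < 2 * length L
  lt′ = +-cancelˡ-< 2 _ _ (begin-strict
    2 + length W′          ≤⟨ +-monoˡ-≤ (length W′) (≰⇒> many) ⟩
    count y W + length W′  ≡⟨ length-filter-∁ (_≟ y) W ⟨
    length W               <⟨ lt ⟩
    2 * suc (length L)     ≡⟨ *-suc 2 (length L) ⟩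
    2 + 2 * length L       ∎)
    where open ≤-Reasoning

-- Doubling `F` makes each of its colours occur twice, so an element that occurs at most once in
-- `F ++ F` is not in `F`.
avoid : ∀ {L} F → Unique L → length F < length L → ∃ λ y → y ∈ L × y ∉ F
avoid {L} F u lt with rare-element {L} {F ++ F} u bound
  where
  open ≤-Reasoning
  bound : length (F ++ F) < 2 * length L
  bound = begin-strict
    length (F ++ F)      ≡⟨ length-++ F ⟩
    length F + length F  <⟨ +-mono-< lt lt ⟩
    length L + length L  ≡⟨ cong (length L +_) (sym (+-identityʳ _)) ⟩
    2 * length L         ∎
... | y , y∈ , few = y , y∈ , λ y∈F → <⇒≱ (+-mono-≤ (∈⇒count y∈F) (∈⇒count y∈F))
        (subst (_≤ 1) (count-++ y F F) few)

-- Cycles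

TwoNeighbours : {A : Set} (R : A → A → Set) → List A → A → Set
TwoNeighbours R cyc v =
  ∃₂ λ p s → p ∈ cyc × s ∈ cyc × R p v × R v s × p ≢ s × p ≢ v × s ≢ v

module _ {A : Set} {R : A → A → Set} where

  last-link : ∀ {x y z} zs → Linked R (y ∷ z ∷ zs ++ [ x ]) → ∃ λ w → w ∈ z ∷ zs × R w x
  last-link []        (_ ∷ r ∷ _) = _ , here refl , r
  last-link (w ∷ zs)  (_ ∷ l)     with last-link zs l
  ... | t , t∈ , r = t , there t∈ , r

  -- Walk along the open path to `v`. Only the last entry has `x` as its successor, and then its
  -- predecessor must not be `x`. The first call has `u` equal to `x`, which the length condition
  -- excuses; after one step `x ∉ ys` gives `u ≢ x`.
  interior-neighbours : ∀ {x u v} ys → Linked R (u ∷ ys ++ [ x ]) → Unique (u ∷ ys) → x ∉ ys →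
                        (2 ≤ length ys) ⊎ (u ≢ x) → v ∈ ys → TwoNeighbours R (x ∷ u ∷ ys) v
  interior-neighbours (v ∷ []) (r ∷ r′ ∷ _) ((u≢v ∷ _) ∷ _) x∉ c (here refl) =
    _ , _ , there (here refl) , here refl , r , r′ , u≢x c , u≢v , λ { refl → x∉ (here refl) }
    where
    u≢x : ∀ {u x} → (2 ≤ 1) ⊎ (u ≢ x) → u ≢ x
    u≢x (inj₁ (s≤s ()))
    u≢x (inj₂ ne) = ne
  interior-neighbours (v ∷ w ∷ ys) (r ∷ r′ ∷ _) ((u≢v ∷ u≢w ∷ _) ∷ (v≢w ∷ _) ∷ _) x∉ c (here refl) =
    _ , _ , there (here refl) , there (there (there (here refl))) , r , r′ , u≢w , u≢v , v≢w ∘ sym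
  interior-neighbours (y ∷ ys) (_ ∷ l) (_ ∷ u) x∉ c (there v∈)
    with interior-neighbours ys l u (x∉ ∘ there) (inj₂ λ { refl → x∉ (here refl) }) v∈
  ... | p , s , p∈ , s∈ , rest = p , s , grow p∈ , grow s∈ , rest
    where
    grow : ∀ {x u y : A} {ys z} → z ∈ x ∷ y ∷ ys → z ∈ x ∷ u ∷ y ∷ ys
    grow (here e)  = here e
    grow (there e) = there (there e)

cycle-neighbours : ∀ {G cyc v} → IsCycle G cyc → v ∈ cyc → TwoNeighbours (Adj G) cyc v
cycle-neighbours {cyc = x ∷ y ∷ []} (s≤s (s≤s ()) , _) (here refl)
cycle-neighbours {cyc = x ∷ y ∷ z ∷ xs} (_ , (x≢y ∷ x∉) ∷ y∉ ∷ _ , r ∷ l) (here refl)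
  with last-link xs l
... | w , w∈ , r′ = w , y , there (there w∈) , there (here refl) , r′ , r ,
  (All.lookup y∉ w∈ ∘ sym) , (All.lookup x∉ w∈ ∘ sym) , x≢y ∘ sym
cycle-neighbours {G} {x ∷ xs} (s≤s 2≤ , u@(x∉ ∷ _) , l) (there v∈)
  with interior-neighbours xs l u (λ x∈ → All.lookup x∉ x∈ refl) (inj₁ 2≤) v∈
... | p , s , p∈ , s∈ , rest = p , s , merge p∈ , merge s∈ , rest
  where
  merge : ∀ {z} → z ∈ x ∷ x ∷ xs → z ∈ x ∷ xs
  merge (here e)  = here e
  merge (there e) = e

Near : (G : Graph) → V G → V G → Set
Near G v u = Adj G u v ⊎ Adj G v u

AcyclicOn : (G : Graph) → (V G → ℕ) → (V G → Set) → Set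
AcyclicOn G c R = ∀ cyc → IsCycle G cyc → All R cyc → ∀ a → ¬ All (λ v → c v ≡ a) cyc

All-⊎ : ∀ {A : Set} {T R : A → Set} {xs} → All (λ x → T x ⊎ R x) xs → (∃ λ x → x ∈ xs × T x) ⊎ All R xs
All-⊎ [] = inj₂ []
All-⊎ (inj₁ t ∷ _) = inj₁ (_ , here refl , t)
All-⊎ (inj₂ r ∷ ps) with All-⊎ ps
... | inj₁ (x , x∈ , t) = inj₁ (x , there x∈ , t)
... | inj₂ rs           = inj₂ (r ∷ rs)

-- A monochromatic cycle within `R′` but not within `R` meets some `v` in `T`. Its two neighbours on
-- the cycle are distinct and share the colour of `v`, which the second hypothesis forbids.
extend-acyclic : ∀ {G c} {R R′ : V G → Set} (T : V G → Set) →
  (∀ x → R′ x → T x ⊎ R x) →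
  (∀ v u u′ → T v → R′ u → R′ u′ → u ≢ v → u′ ≢ v → Near G v u → Near G v u′ →
     c u ≡ c v → c u′ ≡ c v → u ≡ u′) →
  AcyclicOn G c R → AcyclicOn G c R′
extend-acyclic {G} {c} T split few acyc cyc isC all a mono with All-⊎ (All.map (split _) all)
... | inj₂ old = acyc cyc isC old a mono
... | inj₁ (v , v∈ , t) with cycle-neighbours {G} isC v∈
...   | p , s , p∈ , s∈ , r , r′ , p≢s , p≢v , s≢v =
  p≢s (few v p s t (All.lookup all p∈) (All.lookup all s∈) p≢v s≢v (inj₁ r) (inj₂ r′)
    (same p∈) (same s∈))
  where
  same : ∀ {u} → u ∈ cyc → c u ≡ c v
  same u∈ = trans (All.lookup mono u∈) (sym (All.lookup mono v∈))

-- The vertex (t , i) is corner i of the t-th copy of the 4-cycle P₂ □ P₂.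
Place : Set
Place = ℕ × Fin 4

next : Fin 4 → Fin 4
next zero                   = suc zero
next (suc zero)             = suc (suc zero)
next (suc (suc zero))       = suc (suc (suc zero))
next (suc (suc (suc zero))) = zero

-- Besides its predecessor, the copy t has at most one earlier neighbouring copy, called D t.
data Edge (D : ℕ → ℕ) : Place → Place → Set where
  ring : ∀ t i → Edge D (t , i) (t , next i)
  step : ∀ t i → Edge D (t , i) (suc t , i)
  down : ∀ {t} i → D t < t → Edge D (D t , i) (t , i)

record Layout (G : Graph) (N : ℕ) (D : ℕ → ℕ) : Set where
  field
    unique     : Unique (vertices G)
    complete   : ∀ v → v ∈ vertices G
    size       : length (vertices G) ≡ N * 4
    place      : V G → Place
    injective  : ∀ {u v} → place u ≡ place v → u ≡ v
    bounded    : ∀ v → proj₁ (place v) < N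
    surjective : ∀ {t} i → t < N → ∃ λ v → place v ≡ (t , i)
    adjacent   : ∀ {u v} → Adj G u v → Edge D (place u) (place v) ⊎ Edge D (place v) (place u)

-- A colouring order. The vertices are cut into consecutive blocks of k = 1 + j, each to be coloured
-- injectively; loc lists the earlier neighbours in other blocks and in the same or the adjacent copies.
-- For the budget: a vertex with e earlier vertices in its block and m earlier neighbours elsewhere
-- (one of them in D t) has at most e + m / 2 forbidden colours.
record Schedule (j : ℕ) : Set where
  k : ℕ
  k = suc j
  field
    pos : Place → ℕ
    loc : Place → List ℕ
  Charged : Place → Place → Set
  Charged x y = pos x / k ≡ pos y / k
              ⊎ (pos x < pos y × pos x ∈ loc y) ⊎ (pos y < pos x × pos y ∈ loc x)
  field
    ring-charged  : ∀ t i → Charged (t , i) (t , next i)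
    step-charged  : ∀ t i → Charged (t , i) (suc t , i)
    pos-mono      : ∀ {s t} i → s < t → pos (s , i) < pos (t , i)
    pos-injective : ∀ {x y} → pos x ≡ pos y → x ≡ y
    budget        : ∀ x → 2 * (pos x % k) + suc (length (loc x)) < 2 * k

-- The greedy colouring along a schedule

update : (ℕ → ℕ) → ℕ → ℕ → ℕ → ℕ
update C n y q with q ≟ n
... | yes _ = y
... | no  _ = C q

update-same : ∀ C n y → update C n y n ≡ y
update-same C n y with n ≟ n
... | yes _ = refl
... | no ne = contradiction refl ne

update-other : ∀ C {n q} y → q ≢ n → update C n y q ≡ C q
update-other C {n} {q} y ne with q ≟ n
... | yes eq = contradiction eq ne
... | no _   = refl

module Greedy {G N D} (lay : Layout G N D) {j} (S : Schedule j)
              (L : V G → List ℕ) (uniform : IsUniformListAssignment G (suc j) L) where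
  open Layout lay
  open Schedule S

  p : V G → ℕ
  p v = pos (place v)

  p-injective : ∀ {u v} → p u ≡ p v → u ≡ v
  p-injective = injective ∘ pos-injective

  earlier : Place → List ℕ
  earlier (t , i) = pos (D t , i) ∷ loc (t , i)

  Covered : Place → Place → Set
  Covered x y = pos x < pos y → pos x / k ≡ pos y / k ⊎ pos x ∈ earlier y

  charged-covered : ∀ {x y} → Charged x y → Covered x y × Covered y x
  charged-covered (inj₁ eq)               = (λ _ → inj₁ eq) , (λ _ → inj₁ (sym eq))
  charged-covered (inj₂ (inj₁ (lt , ∈l))) = (λ _ → inj₂ (there ∈l)) , (λ gt → contradiction lt (<-asym gt))
  charged-covered (inj₂ (inj₂ (gt , ∈l))) = (λ lt → contradiction lt (<-asym gt)) , (λ _ → inj₂ (there ∈l))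

  -- A `down` edge always runs forward, since `pos` grows with the copy at a fixed corner, and its
  -- starting point heads the list `earlier`.
  edge-covered : ∀ {x y} → Edge D x y → Covered x y × Covered y x
  edge-covered (ring t i)  = charged-covered (ring-charged t i)
  edge-covered (step t i)  = charged-covered (step-charged t i)
  edge-covered (down i lt) =
    (λ _ → inj₂ (here refl)) , (λ gt → contradiction gt (<-asym (pos-mono i lt)))

  near-edge : ∀ {v u} → Near G v u → Edge D (place u) (place v) ⊎ Edge D (place v) (place u)
  near-edge (inj₁ a) = adjacent a
  near-edge (inj₂ a) = Sum.swap (adjacent a)

  near-covered : ∀ {v u} → Near G v u → p u < p v → p u / k ≡ p v / k ⊎ p u ∈ earlier (place v)
  near-covered near lt with near-edge near
  ... | inj₁ e = proj₁ (edge-covered e) lt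
  ... | inj₂ e = proj₂ (edge-covered e) lt

  -- The greedy invariant at one vertex. It speaks only of positions up to `p v`, so later steps
  -- preserve it. The guards `q < p v` matter because `earlier` may list later positions: `D t` is
  -- unrestricted.
  record Fine (C : ℕ → ℕ) (v : V G) : Set where
    field
      listed  : C (p v) ∈ L v
      rainbow : ∀ {q} → q < p v → q / k ≡ p v / k → C q ≢ C (p v)
      sparse  : ∀ {q q′} → q ∈ earlier (place v) → q′ ∈ earlier (place v) → q < p v → q′ < p v →
                C q ≡ C (p v) → C q′ ≡ C (p v) → q ≡ q′
  open Fine

  Fine-cong : ∀ {C C′ v} → (∀ {q} → q ≤ p v → C′ q ≡ C q) → Fine C v → Fine C′ v
  Fine-cong {C} {C′} {v} agree f = record
    { listed  = subst (_∈ L v) (sym here≡) (listed f)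
    ; rainbow = λ lt blk eq → rainbow f lt blk (back lt eq)
    ; sparse  = λ q∈ q′∈ lt lt′ eq eq′ → sparse f q∈ q′∈ lt lt′ (back lt eq) (back lt′ eq′)
    }
    where
    here≡ : C′ (p v) ≡ C (p v)
    here≡ = agree ≤-refl
    back : ∀ {q} → q < p v → C′ q ≡ C′ (p v) → C q ≡ C (p v)
    back lt eq = trans (sym (agree (<⇒≤ lt))) (trans eq here≡)

  mates : ℕ → List ℕ
  mates n = map (_+ n / k * k) (upTo (n % k))

  ∈-mates : ∀ {q n} → q < n → q / k ≡ n / k → q ∈ mates n
  ∈-mates {q} {n} lt eq = subst (_∈ mates n) (sym q≡) (∈-map⁺ (_+ n / k * k) (∈-upTo⁺ r<))
    where
    q≡ : q ≡ q % k + n / k * k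
    q≡ = trans (m≡m%n+[m/n]*n q k) (cong (λ m → q % k + m * k) eq)
    r< : q % k < n % k
    r< = +-cancelʳ-< (n / k * k) _ _ (subst₂ _<_ q≡ (m≡m%n+[m/n]*n n k) lt)

  -- Each block mate is entered twice and each earlier neighbour once. A colour occurring at most
  -- once in `M ++ M ++ E` is therefore absent from `M` and occurs at most once in `E`; by `budget`
  -- this list is shorter than twice the colour list.
  colour-next : ∀ C v → ∃ λ y → Fine (update C (p v) y) v
  colour-next C v = y , record
    { listed  = subst (_∈ L v) (sym (update-same C n y)) y∈
    ; rainbow = λ lt blk eq → twice-mate (∈-map⁺ C (∈-mates lt blk)) (old lt eq)
    ; sparse  = λ q∈ q′∈ lt lt′ eq eq′ → repeated q∈ q′∈ (old lt eq) (old lt′ eq′)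
    }
    where
    n = p v
    M = map C (mates n)
    E = map C (earlier (place v))
    length-M : length M ≡ n % k
    length-M = trans (length-map C (mates n))
               (trans (length-map (_+ n / k * k) (upTo (n % k))) (length-upTo (n % k)))
    few : length (M ++ M ++ E) < 2 * length (L v)
    few = begin-strict
      length (M ++ M ++ E)                          ≡⟨ trans (length-++ M) (cong (length M +_) (length-++ M)) ⟩
      length M + (length M + length E)              ≡⟨ cong₂ (λ a b → a + (a + b)) length-M
                                                         (length-map C (earlier (place v))) ⟩
      n % k + (n % k + suc (length (loc (place v)))) ≡⟨ solve 2 (λ a b → a :+ (a :+ b) := con 2 :* a :+ b) refl
                                                         (n % k) _ ⟩
      2 * (n % k) + suc (length (loc (place v)))    <⟨ budget (place v) ⟩
      2 * k                                         ≡⟨ cong (2 *_) (proj₂ (uniform v)) ⟨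
      2 * length (L v)                              ∎
      where
      open ≤-Reasoning
      open +-*-Solver
    choice = rare-element {L v} {M ++ M ++ E} (proj₁ (uniform v)) few
    y  = proj₁ choice
    y∈ = proj₁ (proj₂ choice)
    old : ∀ {q} → q < n → update C n y q ≡ update C n y n → C q ≡ y
    old lt eq = trans (sym (update-other C y (<⇒≢ lt))) (trans eq (update-same C n y))
    total : count y M + (count y M + count y E) ≤ 1
    total = subst (_≤ 1) (trans (count-++ y M (M ++ E)) (cong (count y M +_) (count-++ y M E)))
              (proj₂ (proj₂ choice))
    twice-mate : ∀ {x} → x ∈ M → x ≢ y
    twice-mate x∈ refl =
      <⇒≱ (+-mono-≤ (∈⇒count x∈) (≤-trans (∈⇒count x∈) (m≤m+n _ (count y E)))) total
    repeated : ∀ {q q′} → q ∈ earlier (place v) → q′ ∈ earlier (place v) → C q ≡ y → C q′ ≡ y → q ≡ q′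
    repeated {q} {q′} q∈ q′∈ eq eq′ with q ≟ q′
    ... | yes same = same
    ... | no ne = contradiction total (<⇒≱
      (≤-trans (two-in-map ne q∈ q′∈ eq eq′) (≤-trans (m≤n+m _ (count y M)) (m≤n+m _ (count y M)))))

  colour-prefix : ∀ n → ∃ λ C → ∀ v → p v < n → Fine C v
  colour-prefix zero = (λ _ → 0) , λ _ ()
  colour-prefix (suc n) with colour-prefix n | any? (λ v → p v ≟ n) (vertices G)
  -- Position `n` is vacant, so there is nothing to colour.
  ... | C , fine | no none =
    C , λ v lt → fine v (≤∧≢⇒< (s≤s⁻¹ lt) λ eq → none (lose (complete v) eq))
  ... | C , fine | yes some with find some
  ...   | w , _ , refl with colour-next C w
  ...     | y , fine-w = update C (p w) y , all-fine
    where
    all-fine : ∀ v → p v < suc (p w) → Fine (update C (p w) y) v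
    all-fine v lt with p v ≟ p w
    ... | yes eq = subst (Fine _) (p-injective (sym eq)) fine-w
    ... | no ne  = Fine-cong (λ q≤ → update-other C y (<⇒≢ (≤-<-trans q≤ (≤∧≢⇒< (s≤s⁻¹ lt) ne))))
                     (fine v (≤∧≢⇒< (s≤s⁻¹ lt) ne))

  bound : ℕ
  bound = suc (foldr _⊔_ 0 (map p (vertices G)))

  p<bound : ∀ v → p v < bound
  p<bound v = s≤s (below (∈-map⁺ p (complete v)))
    where
    below : ∀ {m ms} → m ∈ ms → m ≤ foldr _⊔_ 0 ms
    below (here refl)          = m≤m⊔n _ _
    below {ms = m ∷ _} (there m∈) = ≤-trans (below m∈) (m≤n⊔m m _)

  colouring : ∃ λ C → ∀ v → Fine C v
  colouring with colour-prefix bound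
  ... | C , fine = C , λ v → fine v (p<bound v)

  module _ {C} (fine : ∀ v → Fine C v) where

    -- Vertices are added by position. Earlier neighbours in the same block have other colours by
    -- `rainbow`; the rest are listed in `earlier`, and by `sparse` at most one of them has the
    -- colour of the new vertex.
    acyclic-prefix : ∀ n → AcyclicOn G (C ∘ p) (λ v → p v < n)
    acyclic-prefix zero (x ∷ xs) isC (() ∷ _)
    acyclic-prefix (suc n) = extend-acyclic {G} (λ v → p v ≡ n) split one (acyclic-prefix n)
      where
      split : ∀ x → p x < suc n → p x ≡ n ⊎ p x < n
      split x lt with p x ≟ n
      ... | yes eq = inj₁ eq
      ... | no ne  = inj₂ (≤∧≢⇒< (s≤s⁻¹ lt) ne)
      one : ∀ v u u′ → p v ≡ n → p u < suc n → p u′ < suc n → u ≢ v → u′ ≢ v →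
            Near G v u → Near G v u′ → C (p u) ≡ C (p v) → C (p u′) ≡ C (p v) → u ≡ u′
      one v u u′ refl lt lt′ ne ne′ near near′ eq eq′ =
        p-injective (sparse (fine v) (outside lt< near eq) (outside lt′< near′ eq′) lt< lt′< eq eq′)
        where
        lt<  = ≤∧≢⇒< (s≤s⁻¹ lt) (ne ∘ p-injective)
        lt′< = ≤∧≢⇒< (s≤s⁻¹ lt′) (ne′ ∘ p-injective)
        outside : ∀ {u} → p u < p v → Near G v u → C (p u) ≡ C (p v) → p u ∈ earlier (place v)
        outside lt near eq with near-covered near lt
        ... | inj₁ blk = contradiction eq (rainbow (fine v) lt blk)
        ... | inj₂ ∈e  = ∈e

    acyclic : AcyclicOn G (C ∘ p) (λ v → p v < bound)
    acyclic = acyclic-prefix bound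

    block-injective : ∀ {u v} → p u / k ≡ p v / k → C (p u) ≡ C (p v) → u ≡ v
    block-injective {u} {v} blk eq with <-cmp (p u) (p v)
    ... | tri< lt _ _  = contradiction eq (rainbow (fine v) lt blk)
    ... | tri≈ _ same _ = p-injective same
    ... | tri> _ _ gt  = contradiction (sym eq) (rainbow (fine u) gt (sym blk))

    -- Vertices of one colour lie in different blocks, and the positions below `n` meet `⌈ n / k ⌉`
    -- blocks. The bound `n` is free because the repair for `k = 3` applies this to an initial part
    -- only.
    class-bound : ∀ {xs a} n → Unique xs → All (λ v → C (p v) ≡ a × p v < n) xs → length xs ≤ ⌈ n / k ⌉
    class-bound {xs} {a} n u all = begin
      length xs                         ≡⟨ length-map (λ v → p v / k) xs ⟨
      length (map (λ v → p v / k) xs)   ≤⟨ Unique-⊆⇒length-≤ (Unique-map⁺ inj u) sub ⟩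
      length (upTo ⌈ n / k ⌉)           ≡⟨ length-upTo ⌈ n / k ⌉ ⟩
      ⌈ n / k ⌉                         ∎
      where
      open ≤-Reasoning
      inj : ∀ {x y} → x ∈ xs → y ∈ xs → p x / k ≡ p y / k → x ≡ y
      inj x∈ y∈ blk = block-injective blk
        (trans (proj₁ (All.lookup all x∈)) (sym (proj₁ (All.lookup all y∈))))
      block< : ∀ {q} → q < n → q / k < ⌈ n / k ⌉
      block< {q} lt = begin-strict
        q / k        <⟨ n<1+n (q / k) ⟩
        suc (q / k)  ≡⟨ trans (m/n≡1+[m∸n]/n (m≤n+m k q)) (cong (λ m → suc (m / k)) (m+n∸n≡m q k)) ⟨
        (q + k) / k  ≤⟨ /-monoˡ-≤ k (≤-trans (≤-reflexive (+-suc q j)) (+-monoˡ-≤ j lt)) ⟩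
        (n + j) / k  ∎
      sub : ∀ {b} → b ∈ map (λ v → p v / k) xs → b ∈ upTo ⌈ n / k ⌉
      sub b∈ with ∈-map⁻ _ b∈
      ... | v , v∈ , refl = ∈-upTo⁺ (block< (proj₂ (All.lookup all v∈)))

-- Keeping all positions below the number of vertices ensures that no surplus block is opened.
scheduled⇒arborable : ∀ {G N D j} → Layout G N D → (S : Schedule j) →
  (∀ {t} i → t < N → Schedule.pos S (t , i) < N * 4) → EquitablyListArborable G (suc j)
scheduled⇒arborable {G} {N} {D} {j} lay S inside L uniform =
  C ∘ p , (λ v → Fine.listed (fine v)) , equitable ,
  λ a cyc isC → acyclic fine cyc isC (All.tabulate λ {v} _ → p<bound v) a
  where
  open Layout lay
  open Greedy lay S L uniform
  C = proj₁ colouring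
  fine = proj₂ colouring
  equitable : IsEquitable G (suc j) (C ∘ p)
  equitable a = class-bound fine _ (Unique.filter⁺ (λ v → C (p v) ≟ a) unique) (All.tabulate λ {v} v∈ →
    proj₂ (∈-filter⁻ (λ v → C (p v) ≟ a) {xs = vertices G} v∈) ,
    subst (p v <_) (sym size) (inside (proj₂ (place v)) (bounded v)))

pattern 0F = zero
pattern 1F = suc zero
pattern 2F = suc (suc zero)
pattern 3F = suc (suc (suc zero))

-- Lexicographic order, for k ≥ 5

module Lexicographic (j : ℕ) where

  k : ℕ
  k = 5 + j

  pos : Place → ℕ
  pos (t , i) = toℕ i + t * 4

  -- The first argument is the offset of `p` in its block. A neighbour at distance 1, 3 or 4 before
  -- `p` leaves the block when the distance exceeds the offset. The surplus entries `p ∸ 1` at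
  -- offsets 1 and 2 fit into the budget.
  loc-at : ℕ → ℕ → List ℕ
  loc-at 0 p = p ∸ 1 ∷ p ∸ 3 ∷ p ∸ 4 ∷ []
  loc-at 1 p = p ∸ 1 ∷ p ∸ 3 ∷ p ∸ 4 ∷ []
  loc-at 2 p = p ∸ 1 ∷ p ∸ 3 ∷ p ∸ 4 ∷ []
  loc-at 3 p = p ∸ 4 ∷ []
  loc-at (suc (suc (suc (suc _)))) p = []

  loc : Place → List ℕ
  loc x = loc-at (pos x % k) (pos x)

  same-block : ∀ d q → d ≤ (d + q) % k → q / k ≡ (d + q) / k
  same-block d q d≤ = begin
    q / k                    ≡⟨ cong (_/ k) q≡ ⟩
    (r + b * k) / k          ≡⟨ +-distrib-/-∣ʳ r (n∣m*n b) ⟩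
    r / k + b * k / k        ≡⟨ cong₂ _+_ (m<n⇒m/n≡0 r<k) (m*n/n≡m b k) ⟩
    b                        ∎
    where
    open ≡-Reasoning
    b = (d + q) / k
    r = (d + q) % k ∸ d
    r<k : r < k
    r<k = ≤-<-trans (m∸n≤m _ d) (m%n<n (d + q) k)
    q≡ : q ≡ r + b * k
    q≡ = +-cancelˡ-≡ d _ _ (trans (m≡m%n+[m/n]*n (d + q) k)
      (trans (cong (_+ b * k) (sym (m+[n∸m]≡n d≤))) (+-assoc d r (b * k))))

  -- Position differences along edges: 1 around the 4-cycle, 3 for its closing edge, 4 between
  -- consecutive copies.
  data Offset : ℕ → Set where
    one   : Offset 1
    three : Offset 3
    four  : Offset 4

  covered : ∀ {d} → Offset d → ∀ q → q / k ≡ (d + q) / k ⊎ q ∈ loc-at ((d + q) % k) (d + q)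
  covered {d} o q with d ≤? (d + q) % k
  ... | yes d≤ = inj₁ (same-block d q d≤)
  ... | no d≰  = inj₂ (listed o ((d + q) % k) (≰⇒> d≰))
    where
    listed : ∀ {d} → Offset d → ∀ e → e < d → q ∈ loc-at e (d + q)
    listed one 0 _ = here refl
    listed one (suc e) (s≤s ())
    listed three 0 _ = there (here refl)
    listed three 1 _ = there (here refl)
    listed three 2 _ = there (here refl)
    listed three (suc (suc (suc e))) (s≤s (s≤s (s≤s ())))
    listed four 0 _ = there (there (here refl))
    listed four 1 _ = there (there (here refl))
    listed four 2 _ = there (there (here refl))
    listed four 3 _ = here refl
    listed four (suc (suc (suc (suc e)))) (s≤s (s≤s (s≤s (s≤s ()))))

  forward : ∀ {d} x y → Offset d → pos y ≡ d + pos x →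
            pos x / k ≡ pos y / k ⊎ (pos x < pos y × pos x ∈ loc y) ⊎ (pos y < pos x × pos y ∈ loc x)
  forward {d} x y o eq rewrite eq with covered o (pos x)
  ... | inj₁ blk = inj₁ blk
  ... | inj₂ ∈l  = inj₂ (inj₁ (below o , ∈l))
    where
    below : ∀ {d} → Offset d → pos x < d + pos x
    below one   = n<1+n _
    below three = s≤s (m≤n+m _ 2)
    below four  = s≤s (m≤n+m _ 3)

  backward : ∀ {d} x y → Offset d → pos x ≡ d + pos y →
             pos x / k ≡ pos y / k ⊎ (pos x < pos y × pos x ∈ loc y) ⊎ (pos y < pos x × pos y ∈ loc x)
  backward x y o eq with forward y x o eq
  ... | inj₁ blk      = inj₁ (sym blk)
  ... | inj₂ (inj₁ r) = inj₂ (inj₂ r)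
  ... | inj₂ (inj₂ r) = inj₂ (inj₁ r)

  -- The charge at offsets 2 and 3 is 8: too much for `k = 4`, affordable from `k = 5` on.
  budget-at : ∀ e p → e < k → 2 * e + suc (length (loc-at e p)) < 2 * k
  budget-at 0 p _ = <-≤-trans (toWitness {a? = 4 <? 10} _) (*-monoʳ-≤ 2 (m≤m+n 5 j))
  budget-at 1 p _ = <-≤-trans (toWitness {a? = 6 <? 10} _) (*-monoʳ-≤ 2 (m≤m+n 5 j))
  budget-at 2 p _ = <-≤-trans (toWitness {a? = 8 <? 10} _) (*-monoʳ-≤ 2 (m≤m+n 5 j))
  budget-at 3 p _ = <-≤-trans (toWitness {a? = 8 <? 10} _) (*-monoʳ-≤ 2 (m≤m+n 5 j))
  budget-at e@(suc (suc (suc (suc _)))) p e<k = begin-strict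
    2 * e + 1  <⟨ +-monoʳ-< (2 * e) (n<1+n 1) ⟩
    2 * e + 2  ≡⟨ +-comm (2 * e) 2 ⟩
    2 + 2 * e  ≡⟨ *-suc 2 e ⟨
    2 * suc e  ≤⟨ *-monoʳ-≤ 2 e<k ⟩
    2 * k      ∎
    where open ≤-Reasoning

  pos-inj : ∀ {x y} → pos x ≡ pos y → x ≡ y
  pos-inj {t , i} {t′ , i′} eq with toℕ-injective {i = i} {i′} i≡
    where
    corner : ∀ (i : Fin 4) t → (toℕ i + t * 4) % 4 ≡ toℕ i
    corner i t = trans ([m+kn]%n≡m%n (toℕ i) t 4) (m<n⇒m%n≡m (toℕ<n i))
    i≡ : toℕ i ≡ toℕ i′
    i≡ = trans (sym (corner i t)) (trans (cong (_% 4) eq) (corner i′ t′))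
  ... | refl = cong (_, i) (*-cancelʳ-≡ t t′ 4 (+-cancelˡ-≡ (toℕ i) _ _ eq))

  schedule : Schedule (4 + j)
  schedule = record
    { pos = pos
    ; loc = loc
    ; ring-charged = λ where
        t 0F → forward (t , 0F) (t , 1F) one refl
        t 1F → forward (t , 1F) (t , 2F) one refl
        t 2F → forward (t , 2F) (t , 3F) one refl
        t 3F → backward (t , 3F) (t , 0F) three refl
    ; step-charged = λ t i → forward (t , i) (suc t , i) four (step-pos t i)
    ; pos-mono = λ i lt → +-monoʳ-< (toℕ i) (*-monoˡ-< 4 lt)
    ; pos-injective = pos-inj
    ; budget = λ x → budget-at (pos x % k) (pos x) (m%n<n (pos x) k)
    }
    where
    step-pos : ∀ t i → toℕ i + (4 + t * 4) ≡ 4 + (toℕ i + t * 4)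
    step-pos t i = trans (sym (+-assoc (toℕ i) 4 (t * 4)))
      (trans (cong (_+ t * 4) (+-comm (toℕ i) 4)) (+-assoc 4 (toℕ i) (t * 4)))

  inside : ∀ {N t} i → t < N → pos (t , i) < N * 4
  inside {N} {t} i lt = <-≤-trans (+-monoˡ-< (t * 4) (toℕ<n i)) (*-monoˡ-≤ 4 lt)

-- Periodic orders, for k = 3 and k = 4

Row : Set → Set
Row A = Fin 4 → A

row : ∀ {A : Set} → A → A → A → A → Row A
row a b c d 0F = a
row a b c d 1F = b
row a b c d 2F = c
row a b c d 3F = d

module _ (k : ℕ) .{{_ : NonZero k}} where

  ChargedIn : ℕ → List ℕ → ℕ → List ℕ → Set
  ChargedIn p a q b = p / k ≡ q / k ⊎ (p < q × p ∈ b) ⊎ (q < p × q ∈ a)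

  -- The requirements on a schedule seen from the copy t: A, B, C are the positions in the copies
  -- t, t + 1, t + 2, and a, b are the lists loc in the copies t, t + 1.
  Local : (A B C : Row ℕ) (a b : Row (List ℕ)) → Set
  Local A B C a b =
    (∀ i → ChargedIn (A i) (a i) (A (next i)) (a (next i))) ×
    (∀ i → ChargedIn (A i) (a i) (B i) (b i)) ×
    (∀ i → A i < B i) ×
    (∀ i i′ → A i ≡ A i′ → i ≡ i′) ×
    (∀ i i′ → A i ≢ B i′) ×
    (∀ i i′ → A i < C i′) ×
    (∀ i → 2 * (A i % k) + suc (length (a i)) < 2 * k)

  charged-in? : ∀ p a q b → Dec (ChargedIn p a q b)
  charged-in? p a q b = p / k ≟ q / k ⊎-dec (p <? q ×-dec p ∈? b) ⊎-dec (q <? p ×-dec q ∈? a)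

  -- Decidability allows the irregular initial copies and one full period to be checked by
  -- evaluation.
  local? : ∀ A B C a b → Dec (Local A B C a b)
  local? A B C a b =
    all? (λ i → charged-in? (A i) (a i) (A (next i)) (a (next i))) ×-dec
    all? (λ i → charged-in? (A i) (a i) (B i) (b i)) ×-dec
    all? (λ i → A i <? B i) ×-dec
    all? (λ i → all? λ i′ → A i ≟ A i′ →-dec i Fin.≟ i′) ×-dec
    all? (λ i → all? λ i′ → ¬? (A i ≟ B i′)) ×-dec
    all? (λ i → all? λ i′ → A i <? C i′) ×-dec
    all? (λ i → 2 * (A i % k) + suc (length (a i)) <? 2 * k)

  module _ (m : ℕ) where

    private
      s = m * k

    shift-/ : ∀ p → (s + p) / k ≡ m + p / k
    shift-/ p = trans (+-distrib-/-∣ˡ p (n∣m*n m)) (cong (_+ p / k) (m*n/n≡m m k))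

    shift-% : ∀ p → (s + p) % k ≡ p % k
    shift-% p = trans (cong (_% k) (+-comm s p)) ([m+kn]%n≡m%n p m k)

    shift-charged : ∀ {p a q b} → ChargedIn p a q b →
                    ChargedIn (s + p) (map (s +_) a) (s + q) (map (s +_) b)
    shift-charged {p} {q = q} (inj₁ eq) =
      inj₁ (trans (shift-/ p) (trans (cong (m +_) eq) (sym (shift-/ q))))
    shift-charged (inj₂ (inj₁ (lt , ∈b))) = inj₂ (inj₁ (+-monoʳ-< s lt , ∈-map⁺ (s +_) ∈b))
    shift-charged (inj₂ (inj₂ (lt , ∈a))) = inj₂ (inj₂ (+-monoʳ-< s lt , ∈-map⁺ (s +_) ∈a))

    -- A shift by `m * k` carries blocks to blocks and preserves offsets, so a verified period can
    -- be repeated.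
    shift-local : ∀ {A B C a b} → Local A B C a b →
                  Local (λ i → s + A i) (λ i → s + B i) (λ i → s + C i)
                        (λ i → map (s +_) (a i)) (λ i → map (s +_) (b i))
    shift-local {A} {a = a} (cyc , succ , mono , inj , apart , far , budget) =
      (λ i → shift-charged (cyc i)) ,
      (λ i → shift-charged (succ i)) ,
      (λ i → +-monoʳ-< s (mono i)) ,
      (λ i i′ eq → inj i i′ (+-cancelˡ-≡ s _ _ eq)) ,
      (λ i i′ eq → apart i i′ (+-cancelˡ-≡ s _ _ eq)) ,
      (λ i i′ → +-monoʳ-< s (far i i′)) ,
      (λ i → subst₂ (λ e l → 2 * e + suc l < 2 * k) (sym (shift-% (A i)))
               (sym (length-map (s +_) (a i))) (budget i))

-- Positions in the same or in consecutive copies are compared by the local conditions. For copies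
-- further apart, all of copy `s` precedes all of copy `2 + s`, and positions grow along a fixed
-- corner.
local-schedule : ∀ j (pos : ℕ → Row ℕ) (loc : ℕ → Row (List ℕ)) →
  (∀ t → Local (suc j) (pos t) (pos (1 + t)) (pos (2 + t)) (loc t) (loc (1 + t))) → Schedule j
local-schedule j pos loc local = record
  { pos = λ (t , i) → pos t i
  ; loc = λ (t , i) → loc t i
  ; ring-charged = λ t → proj₁ (local t)
  ; step-charged = λ t → proj₁ (proj₂ (local t))
  ; pos-mono = mono
  ; pos-injective = injective _ _
  ; budget = λ (t , i) → proj₂ (proj₂ (proj₂ (proj₂ (proj₂ (proj₂ (local t)))))) i
  }
  where
  mono-step : ∀ t i → pos t i < pos (suc t) i
  mono-step t = proj₁ (proj₂ (proj₂ (local t)))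
  mono-≤ : ∀ {s t} i → s ≤′ t → pos s i ≤ pos t i
  mono-≤ i ≤′-refl       = ≤-refl
  mono-≤ i (≤′-step s≤t) = ≤-trans (mono-≤ i s≤t) (<⇒≤ (mono-step _ i))
  mono : ∀ {s t} i → s < t → pos s i < pos t i
  mono i s<t = <-≤-trans (mono-step _ i) (mono-≤ i (≤⇒≤′ s<t))
  distinct : ∀ {s t} i i′ → s < t → pos s i ≢ pos t i′
  distinct {s} {t} i i′ s<t with suc s ≟ t
  ... | yes refl = proj₁ (proj₂ (proj₂ (proj₂ (proj₂ (local s))))) i i′
  ... | no ne    = <⇒≢ (<-≤-trans (proj₁ (proj₂ (proj₂ (proj₂ (proj₂ (proj₂ (local s)))))) i i′)
                     (mono-≤ i′ (≤⇒≤′ (≤∧≢⇒< s<t ne))))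
  injective : ∀ x y → pos (proj₁ x) (proj₂ x) ≡ pos (proj₁ y) (proj₂ y) → x ≡ y
  injective (s , i) (t , i′) eq with <-cmp s t
  ... | tri< s<t _ _ = contradiction eq (distinct i i′ s<t)
  ... | tri> _ _ t<s = contradiction (sym eq) (distinct i′ i t<s)
  ... | tri≈ _ refl _ = cong (s ,_) (proj₁ (proj₂ (proj₂ (proj₂ (local s)))) i i′ eq)

-- For k = 4 two consecutive copies b, c form two blocks, b₂ b₁ b₃ c₂ and b₀ c₁ c₃ c₀. For an odd number of
-- copies, copy 0 is a block of its own.

module EvenPairs where

  pos : ℕ → Row ℕ
  pos 0 = row 4 1 0 2
  pos 1 = row 7 5 3 6
  pos (suc (suc t)) i = 8 + pos t i

  loc : ℕ → Row (List ℕ)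
  loc 0 = row (1 ∷ 2 ∷ []) [] [] []
  loc 1 = row [] (1 ∷ 3 ∷ []) [] (3 ∷ 2 ∷ [])
  loc 2 = row (9 ∷ 10 ∷ 7 ∷ []) (5 ∷ []) (3 ∷ []) (6 ∷ [])
  loc 3 = row [] (9 ∷ 11 ∷ []) [] (11 ∷ 10 ∷ [])
  loc (suc (suc (suc (suc t)))) i = map (8 +_) (loc (suc (suc t)) i)

  -- Copy 0 has no predecessor, so the lists repeat only from copy 2 on. One period is a pair of
  -- copies, hence two blocks of 4.
  local : ∀ t → Local 4 (pos t) (pos (1 + t)) (pos (2 + t)) (loc t) (loc (1 + t))
  local 0 = toWitness {a? = local? 4 (pos 0) (pos 1) (pos 2) (loc 0) (loc 1)} _
  local 1 = toWitness {a? = local? 4 (pos 1) (pos 2) (pos 3) (loc 1) (loc 2)} _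
  local 2 = toWitness {a? = local? 4 (pos 2) (pos 3) (pos 4) (loc 2) (loc 3)} _
  local 3 = toWitness {a? = local? 4 (pos 3) (pos 4) (pos 5) (loc 3) (loc 4)} _
  local (suc (suc (suc (suc t)))) = shift-local 4 2 (local (suc (suc t)))

  schedule : Schedule 3
  schedule = local-schedule 3 pos loc local

module OddPairs where

  pos : ℕ → Row ℕ
  pos 0 = toℕ
  pos 1 = row 8 5 4 6
  pos 2 = row 11 9 7 10
  pos (suc (suc (suc t))) i = 8 + pos (suc t) i

  loc : ℕ → Row (List ℕ)
  loc 0 = row [] [] [] []
  loc 1 = row (5 ∷ 6 ∷ 0 ∷ []) (1 ∷ []) (2 ∷ []) (3 ∷ [])
  loc 2 = row [] (5 ∷ 7 ∷ []) [] (7 ∷ 6 ∷ [])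
  loc 3 = row (13 ∷ 14 ∷ 11 ∷ []) (9 ∷ []) (7 ∷ []) (10 ∷ [])
  loc 4 = row [] (13 ∷ 15 ∷ []) [] (15 ∷ 14 ∷ [])
  loc (suc (suc (suc (suc (suc t))))) i = map (8 +_) (loc (suc (suc (suc t))) i)

  -- Copy 0 is arranged unlike the later ones, which delays the period of the lists to copy 3.
  local : ∀ t → Local 4 (pos t) (pos (1 + t)) (pos (2 + t)) (loc t) (loc (1 + t))
  local 0 = toWitness {a? = local? 4 (pos 0) (pos 1) (pos 2) (loc 0) (loc 1)} _
  local 1 = toWitness {a? = local? 4 (pos 1) (pos 2) (pos 3) (loc 1) (loc 2)} _
  local 2 = toWitness {a? = local? 4 (pos 2) (pos 3) (pos 4) (loc 2) (loc 3)} _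
  local 3 = toWitness {a? = local? 4 (pos 3) (pos 4) (pos 5) (loc 3) (loc 4)} _
  local 4 = toWitness {a? = local? 4 (pos 4) (pos 5) (pos 6) (loc 4) (loc 5)} _
  local (suc (suc (suc (suc (suc t))))) = shift-local 4 2 (local (suc (suc (suc t))))

  schedule : Schedule 3
  schedule = local-schedule 3 pos loc local

-- For k = 3 three consecutive copies l, a, b, together with corners 2, 3 of the copy m before l and
-- without corners 2, 3 of b, form the blocks m₃ m₂ l₂, l₀ l₁ a₁, l₃ a₂ a₃ and a₀ b₁ b₀.

module Triples where

  pos : ℕ → Row ℕ
  pos 0 = row 3 0 1 2
  pos 1 = row 5 4 7 6
  pos 2 = row 9 10 8 12
  pos 3 = row 15 11 13 14
  pos (suc (suc (suc (suc t)))) i = 12 + pos (suc t) i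

  loc : ℕ → Row (List ℕ)
  loc 0 = row (0 ∷ 2 ∷ []) [] [] []
  loc 1 = row [] (0 ∷ []) (4 ∷ 1 ∷ []) (5 ∷ 2 ∷ [])
  loc 2 = row (5 ∷ []) (8 ∷ 4 ∷ []) [] (8 ∷ 9 ∷ 6 ∷ [])
  loc 3 = row (11 ∷ 14 ∷ 9 ∷ []) [] (11 ∷ 8 ∷ []) []
  loc 4 = row [] (11 ∷ []) (16 ∷ 13 ∷ []) (17 ∷ 14 ∷ [])
  loc (suc (suc (suc (suc (suc t))))) i = map (12 +_) (loc (suc (suc t)) i)

  -- One period is three copies, that is, four blocks of 3.
  local : ∀ t → Local 3 (pos t) (pos (1 + t)) (pos (2 + t)) (loc t) (loc (1 + t))
  local 0 = toWitness {a? = local? 3 (pos 0) (pos 1) (pos 2) (loc 0) (loc 1)} _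
  local 1 = toWitness {a? = local? 3 (pos 1) (pos 2) (pos 3) (loc 1) (loc 2)} _
  local 2 = toWitness {a? = local? 3 (pos 2) (pos 3) (pos 4) (loc 2) (loc 3)} _
  local 3 = toWitness {a? = local? 3 (pos 3) (pos 4) (pos 5) (loc 3) (loc 4)} _
  local 4 = toWitness {a? = local? 3 (pos 4) (pos 5) (pos 6) (loc 4) (loc 5)} _
  local (suc (suc (suc (suc (suc t))))) = shift-local 3 4 (local (suc (suc t)))

  schedule : Schedule 2
  schedule = local-schedule 2 pos loc local

-- Ranges of the periodic positions

-- A copy before the last may reach into the space of its successor, so only the last copy needs a
-- bound of its own.
inside-below : ∀ (pos : ℕ → Row ℕ) n → (∀ t i → pos t i < (2 + t) * 4) → (∀ i → pos n i < suc n * 4) →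
               ∀ {t} i → t < suc n → pos t i < suc n * 4
inside-below pos n near top {t} i (s≤s t≤n) with t ≟ n
... | yes refl = top i
... | no ne    = <-≤-trans (near t i) (*-monoˡ-≤ 4 (s≤s (≤∧≢⇒< t≤n ne)))

module EvenBound where
  open EvenPairs

  near : ∀ t i → pos t i < (2 + t) * 4
  near 0 = toWitness {a? = all? λ i → pos 0 i <? 8} _
  near 1 = toWitness {a? = all? λ i → pos 1 i <? 12} _
  near (suc (suc t)) i = +-monoʳ-< 8 (near t i)

  top : ∀ q i → pos (1 + q * 2) i < (2 + q * 2) * 4
  top 0 = toWitness {a? = all? λ i → pos 1 i <? 8} _
  top (suc q) i = +-monoʳ-< 8 (top q i)

module OddBound where
  open OddPairs

  near : ∀ t i → pos t i < (2 + t) * 4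
  near 0 = toWitness {a? = all? λ i → pos 0 i <? 8} _
  near 1 = toWitness {a? = all? λ i → pos 1 i <? 12} _
  near 2 = toWitness {a? = all? λ i → pos 2 i <? 16} _
  near (suc (suc (suc t))) i = +-monoʳ-< 8 (near (suc t) i)

  top : ∀ q i → pos (q * 2) i < (1 + q * 2) * 4
  top 0 = toWitness {a? = all? λ i → pos 0 i <? 4} _
  top 1 = toWitness {a? = all? λ i → pos 2 i <? 12} _
  top (suc (suc q)) i = +-monoʳ-< 8 (top (suc q) i)

module TripleBound where
  open Triples

  bound : ∀ t i → pos t i ≤ 4 + t * 4
  bound 0 = toWitness {a? = all? λ i → pos 0 i ≤? 4} _
  bound 1 = toWitness {a? = all? λ i → pos 1 i ≤? 8} _
  bound 2 = toWitness {a? = all? λ i → pos 2 i ≤? 12} _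
  bound 3 = toWitness {a? = all? λ i → pos 3 i ≤? 16} _
  bound (suc (suc (suc (suc t)))) i = +-monoʳ-≤ 12 (bound (suc t) i)

  near : ∀ t i → pos t i < (2 + t) * 4
  near t i = ≤-<-trans (bound t i) (+-monoʳ-< 4 (m<n+m (t * 4) {4} (s≤s z≤n)))

  -- With `top₂` this covers every number of copies not divisible by 3. Otherwise corner 3 of the
  -- last copy `2 + q * 3` has position `12 + q * 12`, just past the permitted range; hence the
  -- repair.
  top₁ : ∀ q i → pos (q * 3) i < (1 + q * 3) * 4
  top₁ 0 = toWitness {a? = all? λ i → pos 0 i <? 4} _
  top₁ 1 = toWitness {a? = all? λ i → pos 3 i <? 16} _
  top₁ (suc (suc q)) i = +-monoʳ-< 12 (top₁ (suc q) i)

  top₂ : ∀ q i → pos (1 + q * 3) i < (2 + q * 3) * 4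
  top₂ 0 = toWitness {a? = all? λ i → pos 1 i <? 8} _
  top₂ (suc q) i = +-monoʳ-< 12 (top₂ q i)

  pos-m : ∀ q i → pos (1 + q * 3) i ≡ q * 12 + pos 1 i
  pos-m 0 i       = refl
  pos-m (suc q) i = cong (12 +_) (pos-m q i)

  pos-l : ∀ q i → pos (2 + q * 3) i ≡ q * 12 + pos 2 i
  pos-l 0 i       = refl
  pos-l (suc q) i = cong (12 +_) (pos-l q i)

  -- Corners sharing a block get different greedy colours. The pairs `mates-l`, `mates-m` and
  -- `mates-a` supply `u₁ ≢ u₂`, `d₁ ≢ d₂` and `z₁ ≢ z₂` for the last ladder.
  Mates : ℕ → Fin 4 → Fin 4 → Set
  Mates t i i′ = pos t i / 3 ≡ pos t i′ / 3

  shift-mates : ∀ p q → p / 3 ≡ q / 3 → (12 + p) / 3 ≡ (12 + q) / 3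
  shift-mates p q eq = trans (shift-/ 3 4 p) (trans (cong (4 +_) eq) (sym (shift-/ 3 4 q)))

  mates-a : ∀ q → Mates (q * 3) 2F 3F
  mates-a 0 = refl
  mates-a 1 = refl
  mates-a (suc (suc q)) = shift-mates (pos (3 + q * 3) 2F) (pos (3 + q * 3) 3F) (mates-a (suc q))

  mates-m : ∀ q → Mates (1 + q * 3) 2F 3F
  mates-m 0 = refl
  mates-m (suc q) = shift-mates (pos (1 + q * 3) 2F) (pos (1 + q * 3) 3F) (mates-m q)

  mates-l : ∀ q → Mates (2 + q * 3) 0F 1F
  mates-l 0 = refl
  mates-l (suc q) = shift-mates (pos (2 + q * 3) 0F) (pos (2 + q * 3) 1F) (mates-l q)

-- Completing two colours

count-distinct : ∀ a {xs} → Unique xs → count a xs ≤ 1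
count-distinct a {xs} u = Unique-⊆⇒length-≤ {ys = a ∷ []} (Unique.filter⁺ (_≟ a) u)
  λ {x} x∈ → here (proj₂ (∈-filter⁻ (_≟ a) {xs = xs} x∈))

count-skip : ∀ {a x n} xs → x ≢ a → count a xs ≤ n → count a (x ∷ xs) ≤ n
count-skip xs ne = ≤-trans (≤-reflexive (count-no xs ne))

distinct₂ : ∀ {x y : ℕ} → x ≢ y → Unique (x ∷ y ∷ [])
distinct₂ xy = (xy ∷ []) ∷ [] ∷ []

distinct₃ : ∀ {x y z : ℕ} → x ≢ y → x ≢ z → y ≢ z → Unique (x ∷ y ∷ z ∷ [])
distinct₃ xy xz yz = (xy ∷ xz ∷ []) ∷ distinct₂ yz

-- A ladder with columns u₁ x₁ d₁ and u₂ x₂ d₂ of which only the middle rung x₁ x₂ is uncoloured; z₁ and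
-- z₂ are the colours of the remaining neighbours of the middle rung. By order, one end of the middle rung
-- and then the other can be added with at most one earlier neighbour of its own colour.
record MiddleRung (u₁ u₂ d₁ d₂ z₁ z₂ : ℕ) (M₁ M₂ : List ℕ) : Set where
  field
    x₁ x₂    : ℕ
    x₁∈      : x₁ ∈ M₁
    x₂∈      : x₂ ∈ M₂
    balanced : ∀ a → count a (u₁ ∷ u₂ ∷ d₁ ∷ d₂ ∷ x₁ ∷ x₂ ∷ []) ≤ 2
    order    : (count x₁ (u₁ ∷ d₁ ∷ z₁ ∷ []) ≤ 1 × count x₂ (x₁ ∷ u₂ ∷ d₂ ∷ z₂ ∷ []) ≤ 1)
             ⊎ (count x₂ (u₂ ∷ d₂ ∷ z₂ ∷ []) ≤ 1 × count x₁ (x₂ ∷ u₁ ∷ d₁ ∷ z₁ ∷ []) ≤ 1)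

-- Balance follows once the six entries split into two triples of distinct colours. The split
-- depends on whether `u₁ ≡ d₁` and `u₂ ≡ d₂`; a list of three lets each new colour avoid two
-- others.
middle-rung : ∀ {u₁ u₂ d₁ d₂ z₁ z₂ M₁ M₂} → u₁ ≢ u₂ → d₁ ≢ d₂ → z₁ ≢ z₂ →
              Unique M₁ × length M₁ ≡ 3 → Unique M₂ × length M₂ ≡ 3 →
              MiddleRung u₁ u₂ d₁ d₂ z₁ z₂ M₁ M₂
middle-rung {u₁} {u₂} {d₁} {d₂} {z₁} {z₂} {M₁} {M₂} u≢ d≢ z≢ (uniq₁ , len₁) (uniq₂ , len₂) = solution
  where
  pick₁ : ∀ a b → ∃ λ y → y ∈ M₁ × y ∉ a ∷ b ∷ []
  pick₁ a b = avoid (a ∷ b ∷ []) uniq₁ (≤-reflexive (sym len₁))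
  pick₂ : ∀ a b → ∃ λ y → y ∈ M₂ × y ∉ a ∷ b ∷ []
  pick₂ a b = avoid (a ∷ b ∷ []) uniq₂ (≤-reflexive (sym len₂))

  1ˢᵗ : ∀ {y a b : ℕ} → y ∉ a ∷ b ∷ [] → a ≢ y
  1ˢᵗ y∉ eq = y∉ (here (sym eq))
  2ⁿᵈ : ∀ {y a b : ℕ} → y ∉ a ∷ b ∷ [] → b ≢ y
  2ⁿᵈ y∉ eq = y∉ (there (here (sym eq)))

  one : ∀ {a} x → count a (x ∷ []) ≤ 1
  one {a} x = count-distinct a {x ∷ []} ([] ∷ [])

  count-first : ∀ {a u d} z → z ≢ a → u ≢ d → count a (u ∷ d ∷ z ∷ []) ≤ 1
  count-first {a} {u} {d} z za ud = ≤-trans (≤-reflexive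
    (trans (count-++ a (u ∷ d ∷ []) (z ∷ [])) (trans (cong (_ +_) (count-no [] za)) (+-identityʳ _))))
    (count-distinct a (distinct₂ ud))

  c : ℕ → ℕ → ℕ
  c a x = count a (x ∷ [])

  count-∷ : ∀ a x xs → count a (x ∷ xs) ≡ c a x + count a xs
  count-∷ a x xs = count-++ a (x ∷ []) xs

  two-triples : ∀ {a b b′ b″ e e′ e″} xs →
    Unique (b ∷ b′ ∷ b″ ∷ []) → Unique (e ∷ e′ ∷ e″ ∷ []) →
    count a xs ≡ count a (b ∷ b′ ∷ b″ ∷ e ∷ e′ ∷ e″ ∷ []) → count a xs ≤ 2
  two-triples {a} {b} {b′} {b″} {e} {e′} {e″} xs u u′ eq = begin
    count a xs                                                ≡⟨ eq ⟩
    count a (b ∷ b′ ∷ b″ ∷ e ∷ e′ ∷ e″ ∷ [])                  ≡⟨ count-++ a (b ∷ b′ ∷ b″ ∷ []) (e ∷ e′ ∷ e″ ∷ []) ⟩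
    count a (b ∷ b′ ∷ b″ ∷ []) + count a (e ∷ e′ ∷ e″ ∷ [])   ≤⟨ +-mono-≤ (count-distinct a u) (count-distinct a u′) ⟩
    2                                                         ∎
    where open ≤-Reasoning

  -- Turns the four regroupings below into identities of sums, which the solver proves.
  count₆ : ∀ a p q r s t v → count a (p ∷ q ∷ r ∷ s ∷ t ∷ v ∷ []) ≡
           c a p + (c a q + (c a r + (c a s + (c a t + c a v))))
  count₆ a p q r s t v
    rewrite count-∷ a p (q ∷ r ∷ s ∷ t ∷ v ∷ []) | count-∷ a q (r ∷ s ∷ t ∷ v ∷ [])
          | count-∷ a r (s ∷ t ∷ v ∷ []) | count-∷ a s (t ∷ v ∷ []) | count-∷ a t (v ∷ []) = refl

  open +-*-Solver

  by-columns : ∀ a p q r s t v →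
    count a (p ∷ q ∷ r ∷ s ∷ t ∷ v ∷ []) ≡ count a (p ∷ r ∷ t ∷ q ∷ s ∷ v ∷ [])
  by-columns a p q r s t v = trans (count₆ a p q r s t v) (trans
    (solve 6 (λ p q r s t v → p :+ (q :+ (r :+ (s :+ (t :+ v)))) := p :+ (r :+ (t :+ (q :+ (s :+ v)))))
      refl (c a p) (c a q) (c a r) (c a s) (c a t) (c a v))
    (sym (count₆ a p r t q s v)))

  by-rungs : ∀ a p q r s t v →
    count a (p ∷ q ∷ r ∷ s ∷ t ∷ v ∷ []) ≡ count a (p ∷ q ∷ t ∷ r ∷ s ∷ v ∷ [])
  by-rungs a p q r s t v = trans (count₆ a p q r s t v) (trans
    (solve 6 (λ p q r s t v → p :+ (q :+ (r :+ (s :+ (t :+ v)))) := p :+ (q :+ (t :+ (r :+ (s :+ v)))))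
      refl (c a p) (c a q) (c a r) (c a s) (c a t) (c a v))
    (sym (count₆ a p q t r s v)))

  by-first : ∀ a p q r s t v →
    count a (p ∷ q ∷ r ∷ s ∷ t ∷ v ∷ []) ≡ count a (p ∷ t ∷ v ∷ q ∷ r ∷ s ∷ [])
  by-first a p q r s t v = trans (count₆ a p q r s t v) (trans
    (solve 6 (λ p q r s t v → p :+ (q :+ (r :+ (s :+ (t :+ v)))) := p :+ (t :+ (v :+ (q :+ (r :+ s)))))
      refl (c a p) (c a q) (c a r) (c a s) (c a t) (c a v))
    (sym (count₆ a p t v q r s)))

  by-second : ∀ a p q r s t v →
    count a (p ∷ q ∷ r ∷ s ∷ t ∷ v ∷ []) ≡ count a (q ∷ t ∷ v ∷ p ∷ r ∷ s ∷ [])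
  by-second a p q r s t v = trans (count₆ a p q r s t v) (trans
    (solve 6 (λ p q r s t v → p :+ (q :+ (r :+ (s :+ (t :+ v)))) := q :+ (t :+ (v :+ (p :+ (r :+ s)))))
      refl (c a p) (c a q) (c a r) (c a s) (c a t) (c a v))
    (sym (count₆ a q t v p r s)))

  -- Here `x₁` can agree only with `z₁` and `x₂`, and `x₂` only with `z₂` and `x₁`. Adding `x₁`
  -- first fails only if `x₁`, `x₂` and `z₂` coincide; then `z₁` differs from them and the reverse
  -- order works.
  proper-columns : ∀ {x₁ x₂} → u₁ ≢ x₁ → d₁ ≢ x₁ → u₂ ≢ x₂ → d₂ ≢ x₂ →
    (count x₁ (u₁ ∷ d₁ ∷ z₁ ∷ []) ≤ 1 × count x₂ (x₁ ∷ u₂ ∷ d₂ ∷ z₂ ∷ []) ≤ 1) ⊎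
    (count x₂ (u₂ ∷ d₂ ∷ z₂ ∷ []) ≤ 1 × count x₁ (x₂ ∷ u₁ ∷ d₁ ∷ z₁ ∷ []) ≤ 1)
  proper-columns {x₁} {x₂} u₁x d₁x u₂x d₂x with x₁ ≟ x₂ | z₂ ≟ x₂
  ... | no x≢ | _ = inj₁ (count-skip _ u₁x (count-skip _ d₁x (one z₁)) ,
                          count-skip _ x≢ (count-skip _ u₂x (count-skip _ d₂x (one z₂))))
  ... | yes refl | no z₂x =
    inj₁ (count-skip _ u₁x (count-skip _ d₁x (one z₁)) ,
      ≤-trans (≤-reflexive (count-yes (u₂ ∷ d₂ ∷ z₂ ∷ []) refl))
        (s≤s (count-skip _ u₂x (count-skip _ d₂x (count-skip [] z₂x z≤n)))))
  ... | yes refl | yes refl =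
    inj₂ (count-skip _ u₂x (count-skip _ d₂x (one z₂)) ,
      ≤-trans (≤-reflexive (count-yes (u₁ ∷ d₁ ∷ z₁ ∷ []) refl))
        (s≤s (count-skip _ u₁x (count-skip _ d₁x (count-skip [] z≢ z≤n)))))

  solution : MiddleRung u₁ u₂ d₁ d₂ z₁ z₂ M₁ M₂
  solution with u₁ ≟ d₁ | u₂ ≟ d₂ | pick₁ u₁ d₁ | pick₂ u₂ d₂ | pick₁ u₁ u₂ | pick₂ u₁ u₂ | pick₂ u₁ z₂ | pick₁ u₂ z₁
  -- Both columns have distinct ends, and the triples are the columns.
  ... | no u≢d₁ | no u≢d₂ | x₁ , x₁∈ , x₁∉ | x₂ , x₂∈ , x₂∉ | _ | _ | _ | _ = record
    { x₁∈ = x₁∈ ; x₂∈ = x₂∈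
    ; balanced = λ a → two-triples (u₁ ∷ u₂ ∷ d₁ ∷ d₂ ∷ x₁ ∷ x₂ ∷ [])
        (distinct₃ u≢d₁ (1ˢᵗ x₁∉) (2ⁿᵈ x₁∉)) (distinct₃ u≢d₂ (1ˢᵗ x₂∉) (2ⁿᵈ x₂∉))
        (by-columns a u₁ u₂ d₁ d₂ x₁ x₂)
    ; order = proper-columns (1ˢᵗ x₁∉) (2ⁿᵈ x₁∉) (1ˢᵗ x₂∉) (2ⁿᵈ x₂∉)
    }
  -- Both columns have equal ends: the new colours avoid both, `x₁` joins the rung `u₁ u₂` and `x₂`
  -- the rung `d₁ d₂`.
  ... | yes refl | yes refl | _ | _ | x₁ , x₁∈ , x₁∉ | x₂ , x₂∈ , x₂∉ | _ | _ = record
    { x₁∈ = x₁∈ ; x₂∈ = x₂∈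
    ; balanced = λ a → two-triples (u₁ ∷ u₂ ∷ d₁ ∷ d₂ ∷ x₁ ∷ x₂ ∷ [])
        (distinct₃ u≢ (1ˢᵗ x₁∉) (2ⁿᵈ x₁∉)) (distinct₃ d≢ (1ˢᵗ x₂∉) (2ⁿᵈ x₂∉))
        (by-rungs a u₁ u₂ d₁ d₂ x₁ x₂)
    ; order = proper-columns (1ˢᵗ x₁∉) (1ˢᵗ x₁∉) (2ⁿᵈ x₂∉) (2ⁿᵈ x₂∉)
    }
  -- Only the first column has equal ends: the triples are `u₁ x₁ x₂` and `u₂ d₁ d₂`. As `x₂` may
  -- repeat `u₂` or `d₂`, it avoids `z₂`, and `x₁` then avoids `x₂`.
  ... | yes refl | no u≢d₂ | _ | _ | _ | _ | x₂ , x₂∈ , x₂∉ | _ with pick₁ u₁ x₂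
  ...   | x₁ , x₁∈ , x₁∉ = record
    { x₁∈ = x₁∈ ; x₂∈ = x₂∈
    ; balanced = λ a → two-triples (u₁ ∷ u₂ ∷ d₁ ∷ d₂ ∷ x₁ ∷ x₂ ∷ [])
        (distinct₃ (1ˢᵗ x₁∉) (1ˢᵗ x₂∉) (2ⁿᵈ x₁∉ ∘ sym)) (distinct₃ (u≢ ∘ sym) u≢d₂ d≢)
        (by-first a u₁ u₂ d₁ d₂ x₁ x₂)
    ; order = inj₁ (count-skip _ (1ˢᵗ x₁∉) (count-skip _ (1ˢᵗ x₁∉) (one z₁)) ,
        count-skip _ (2ⁿᵈ x₁∉ ∘ sym) (count-first z₂ (2ⁿᵈ x₂∉) u≢d₂))
    }
  solution | no u≢d₁ | yes refl | _ | _ | _ | _ | _ | x₁ , x₁∈ , x₁∉ with pick₂ u₂ x₁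
  ...   | x₂ , x₂∈ , x₂∉ = record
    { x₁∈ = x₁∈ ; x₂∈ = x₂∈
    ; balanced = λ a → two-triples (u₁ ∷ u₂ ∷ d₁ ∷ d₂ ∷ x₁ ∷ x₂ ∷ [])
        (distinct₃ (1ˢᵗ x₁∉) (1ˢᵗ x₂∉) (2ⁿᵈ x₂∉)) (distinct₃ u≢d₁ u≢ d≢)
        (by-second a u₁ u₂ d₁ d₂ x₁ x₂)
    ; order = inj₁ (count-first z₁ (2ⁿᵈ x₁∉) u≢d₁ ,
        count-skip _ (2ⁿᵈ x₂∉) (count-skip _ (1ˢᵗ x₂∉) (count-skip _ (1ˢᵗ x₂∉) (one z₂))))
    }

-- Recolouring the last copy

prev : Fin 4 → Fin 4
prev 0F = 3F
prev 1F = 0F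
prev 2F = 1F
prev 3F = 2F

prev-next : ∀ i → prev (next i) ≡ i
prev-next 0F = refl
prev-next 1F = refl
prev-next 2F = refl
prev-next 3F = refl

in-edge : ∀ {D x y} → Edge D x y →
  x ≡ (proj₁ y , prev (proj₂ y)) ⊎ (suc (proj₁ x) , proj₂ x) ≡ y ⊎ x ≡ (D (proj₁ y) , proj₂ y)
in-edge (ring t i)  = inj₁ (cong (t ,_) (sym (prev-next i)))
in-edge (step t i)  = inj₂ (inj₁ refl)
in-edge (down i _)  = inj₂ (inj₂ refl)

out-edge : ∀ {D x y} → Edge D x y → y ≡ (proj₁ x , next (proj₂ x)) ⊎ proj₁ x < proj₁ y
out-edge (ring t i)  = inj₁ refl
out-edge (step t i)  = inj₂ (n<1+n t)
out-edge (down i lt) = inj₂ lt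

length-filter-map : ∀ {A : Set} (f : A → ℕ) a xs → length (filter (λ x → f x ≟ a) xs) ≡ count a (map f xs)
length-filter-map f a [] = refl
length-filter-map f a (x ∷ xs) with f x ≟ a
... | yes eq = trans (cong length (filter-accept (λ x → f x ≟ a) eq))
    (trans (cong suc (length-filter-map f a xs)) (sym (count-yes (map f xs) eq)))
... | no ne  = trans (cong length (filter-reject (λ x → f x ≟ a) ne))
    (trans (length-filter-map f a xs) (sym (count-no (map f xs) ne)))

-- The greedy colouring leaves the corners 2 and 3 of the last copy to be recoloured. They are the middle rung
-- of a ladder, and their neighbours in copy D (2 + q * 3) lie in a common block because the index of that
-- copy is divisible by 3; so z₁ ≢ z₂.
module LastLadder {G q D} (lay : Layout G (suc q * 3) D) {e} (e≤q : e ≤ q) (D≡ : D (2 + q * 3) ≡ e * 3)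
                  (L : V G → List ℕ) (uniform : IsUniformListAssignment G 3 L) where
  open Layout lay
  open Triples using (pos; schedule)
  open TripleBound using (Mates; mates-a; mates-m; mates-l; pos-m; pos-l)
  open Greedy lay schedule L uniform

  T₁ T₂ : ℕ
  T₁ = 1 + q * 3
  T₂ = 2 + q * 3

  vertex : ∀ {t} i → t < suc q * 3 → V G
  vertex i lt = proj₁ (surjective i lt)

  T₂< : T₂ < suc q * 3
  T₂< = n<1+n T₂
  T₁< : T₁ < suc q * 3
  T₁< = <-trans (n<1+n T₁) T₂<
  e< : e * 3 < suc q * 3
  e< = *-monoˡ-< 3 (s≤s e≤q)

  -- The letters are new here: `a` is the last copy, `b` its predecessor, `c` the copy `D T₂`. In
  -- the naming of the triples they are of the types l, m and a.
  a₀ a₁ a₂ a₃ b₂ b₃ c₂ c₃ : V G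
  a₀ = vertex 0F T₂<
  a₁ = vertex 1F T₂<
  a₂ = vertex 2F T₂<
  a₃ = vertex 3F T₂<
  b₂ = vertex 2F T₁<
  b₃ = vertex 3F T₁<
  c₂ = vertex 2F e<
  c₃ = vertex 3F e<

  at : ∀ {t} i (lt : t < suc q * 3) → place (vertex i lt) ≡ (t , i)
  at i lt = proj₂ (surjective i lt)

  vertex-unique : ∀ {u t} i (lt : t < suc q * 3) → place u ≡ (t , i) → u ≡ vertex i lt
  vertex-unique i lt eq = injective (trans eq (sym (at i lt)))

  apart : ∀ {t i t′ i′} (lt : t < suc q * 3) (lt′ : t′ < suc q * 3) → (t , i) ≢ (t′ , i′) →
          vertex i lt ≢ vertex i′ lt′
  apart {i = i} {i′ = i′} lt lt′ ne eq = ne (trans (sym (at i lt)) (trans (cong place eq) (at i′ lt′)))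

  e<T₂ : e * 3 < T₂
  e<T₂ = s≤s (≤-trans (*-monoˡ-≤ 3 e≤q) (n≤1+n (q * 3)))

  -- The columns are `a₀ a₃ b₃` and `a₁ a₂ b₂`; the fourth neighbours of `a₃` and `a₂` are `c₃` and
  -- `c₂`.
  Rung : (ℕ → ℕ) → Set
  Rung C = MiddleRung (C (p a₀)) (C (p a₁)) (C (p b₃)) (C (p b₂)) (C (p c₃)) (C (p c₂)) (L a₃) (L a₂)

  module _ {C} (fine : ∀ v → Fine C v) where

    block-mates : ∀ {t i i′} (lt : t < suc q * 3) → Mates t i i′ → i ≢ i′ →
                  C (p (vertex i lt)) ≢ C (p (vertex i′ lt))
    block-mates {i = i} {i′} lt mates ne eq = apart lt lt (λ { refl → ne refl })
      (block-injective fine (subst₂ (λ x y → Schedule.pos schedule x / 3 ≡ Schedule.pos schedule y / 3)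
        (sym (at i lt)) (sym (at i′ lt)) mates) eq)

    rung : Rung C
    rung = middle-rung
      (block-mates T₂< (mates-l q) λ ())
      (block-mates T₁< (sym (mates-m q)) λ ())
      (block-mates e< (sym (mates-a e)) λ ())
      (uniform a₃) (uniform a₂)

  module Recoloured {C} (fine : ∀ v → Fine C v) (rung : Rung C) where
    open MiddleRung rung

    C′ : ℕ → ℕ
    C′ = update (update C (p a₂) x₂) (p a₃) x₁

    c′ : V G → ℕ
    c′ = C′ ∘ p

    c′-a₃ : c′ a₃ ≡ x₁
    c′-a₃ = update-same _ (p a₃) x₁

    a₂≢a₃ : a₂ ≢ a₃
    a₂≢a₃ = apart T₂< T₂< λ ()

    c′-a₂ : c′ a₂ ≡ x₂
    c′-a₂ = trans (update-other _ x₁ (a₂≢a₃ ∘ p-injective)) (update-same C (p a₂) x₂)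

    c′-old : ∀ {v} → v ≢ a₂ → v ≢ a₃ → c′ v ≡ C (p v)
    c′-old ne₂ ne₃ = trans (update-other _ x₁ (ne₃ ∘ p-injective)) (update-other C x₂ (ne₂ ∘ p-injective))

    c′-vertex : ∀ {t i} (lt : t < suc q * 3) → (t , i) ≢ (T₂ , 2F) → (t , i) ≢ (T₂ , 3F) →
                c′ (vertex i lt) ≡ C (p (vertex i lt))
    c′-vertex lt ne₂ ne₃ = c′-old (apart lt T₂< ne₂) (apart lt T₂< ne₃)

    old-a₀ = c′-vertex {i = 0F} T₂< (λ ()) (λ ())
    old-a₁ = c′-vertex {i = 1F} T₂< (λ ()) (λ ())
    old-b₂ = c′-vertex {i = 2F} T₁< (λ eq → <⇒≢ (n<1+n T₁) (cong proj₁ eq)) (λ ())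
    old-b₃ = c′-vertex {i = 3F} T₁< (λ ()) (λ eq → <⇒≢ (n<1+n T₁) (cong proj₁ eq))
    old-c₂ = c′-vertex {i = 2F} e< (λ eq → <⇒≢ e<T₂ (cong proj₁ eq)) (λ ())
    old-c₃ = c′-vertex {i = 3F} e< (λ ()) (λ eq → <⇒≢ e<T₂ (cong proj₁ eq))

    decide : ∀ (u v : V G) → Dec (u ≡ v)
    decide u v with p u ≟ p v
    ... | yes eq = yes (p-injective eq)
    ... | no ne  = no (ne ∘ cong p)

    listed′ : IsLColouring G L c′
    listed′ v with decide v a₂ | decide v a₃
    ... | yes refl | _        = subst (_∈ L a₂) (sym c′-a₂) x₂∈
    ... | no _     | yes refl = subst (_∈ L a₃) (sym c′-a₃) x₁∈
    ... | no ne₂   | no ne₃   = subst (_∈ L v) (sym (c′-old ne₂ ne₃)) (Fine.listed (fine v))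

    -- No copy follows the last one, so only ring neighbours and the two earlier copies remain.
    top-neighbours : ∀ {u} i → Near G (vertex i T₂<) u →
      u ∈ vertex (next i) T₂< ∷ vertex (prev i) T₂< ∷ vertex i T₁< ∷ vertex i e< ∷ []
    top-neighbours {u} i near with near-edge near
    ... | inj₁ into with in-edge (subst (Edge D (place u)) (at i T₂<) into)
    ...   | inj₁ eq        = there (here (vertex-unique (prev i) T₂< eq))
    ...   | inj₂ (inj₁ eq) = there (there (here (vertex-unique i T₁< (cong (λ (t , i) → pred t , i) eq))))
    ...   | inj₂ (inj₂ eq) =
      there (there (there (here (vertex-unique i e< (trans eq (cong (_, i) D≡))))))
    top-neighbours {u} i near | inj₂ out with out-edge (subst (λ x → Edge D x (place u)) (at i T₂<) out)
    ...   | inj₁ eq = here (vertex-unique (next i) T₂< eq)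
    ...   | inj₂ lt = contradiction (bounded u) (<⇒≱ (s≤s lt))

    -- The list `ns` need only contain neighbours within `R′`: the end of the rung that is attached
    -- first does not yet see the other end.
    attach : ∀ {R R′ : V G → Set} v ns {x} → (∀ {u} → Near G v u → R′ u → u ∈ ns) →
             c′ v ≡ x → count x (map c′ ns) ≤ 1 → (∀ w → R′ w → w ≡ v ⊎ R w) →
             AcyclicOn G c′ R → AcyclicOn G c′ R′
    attach {R} {R′} v ns inside refl few split = extend-acyclic {G} (_≡ v) split one
      where
      one : ∀ w u u′ → w ≡ v → R′ u → R′ u′ → u ≢ w → u′ ≢ w → Near G w u → Near G w u′ →
            c′ u ≡ c′ w → c′ u′ ≡ c′ w → u ≡ u′
      one _ u u′ refl r r′ _ _ near near′ eq eq′ with decide u u′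
      ... | yes same = same
      ... | no ne    = contradiction few (<⇒≱ (two-in-map ne (inside near r) (inside near′ r′) eq eq′))

    acyclic-old : AcyclicOn G c′ (λ v → v ≢ a₂ × v ≢ a₃)
    acyclic-old cyc isC old a mono = acyclic fine cyc isC (All.tabulate λ {v} _ → p<bound v) a
      (All.tabulate λ v∈ → let (ne₂ , ne₃) = All.lookup old v∈ in
        trans (sym (c′-old ne₂ ne₃)) (All.lookup mono v∈))

    colours-a₃ : map c′ (a₀ ∷ b₃ ∷ c₃ ∷ []) ≡ C (p a₀) ∷ C (p b₃) ∷ C (p c₃) ∷ []
    colours-a₃ = cong₂ _∷_ old-a₀ (cong₂ _∷_ old-b₃ (cong (_∷ []) old-c₃))

    colours-a₂ : map c′ (a₁ ∷ b₂ ∷ c₂ ∷ []) ≡ C (p a₁) ∷ C (p b₂) ∷ C (p c₂) ∷ []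
    colours-a₂ = cong₂ _∷_ old-a₁ (cong₂ _∷_ old-b₂ (cong (_∷ []) old-c₂))

    near-a₃ : ∀ {u} → Near G a₃ u → u ∈ a₂ ∷ a₀ ∷ b₃ ∷ c₃ ∷ []
    near-a₃ near with top-neighbours 3F near
    ... | here eq                 = there (here eq)
    ... | there (here eq)         = here eq
    ... | there (there u∈)        = there (there u∈)

    near-a₂ : ∀ {u} → Near G a₂ u → u ∈ a₃ ∷ a₁ ∷ b₂ ∷ c₂ ∷ []
    near-a₂ = top-neighbours 2F

    drop : ∀ {u v : V G} {vs} → u ∈ v ∷ vs → u ≢ v → u ∈ vs
    drop (here eq) ne  = contradiction eq ne
    drop (there u∈) _  = u∈

    same-or-not : ∀ (v w : V G) → w ≡ v ⊎ w ≢ v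
    same-or-not v w with decide w v
    ... | yes eq = inj₁ eq
    ... | no ne  = inj₂ ne

    acyclic′ : AcyclicOn G c′ (λ v → p v < bound)
    acyclic′ with order
    ... | inj₁ (few₃ , few₂) =
      attach a₂ (a₃ ∷ a₁ ∷ b₂ ∷ c₂ ∷ []) (λ near _ → near-a₂ near) c′-a₂
        (subst (λ cs → count x₂ cs ≤ 1) (sym (cong₂ _∷_ c′-a₃ colours-a₂)) few₂) (λ w _ → same-or-not a₂ w)
      (attach a₃ (a₀ ∷ b₃ ∷ c₃ ∷ []) (λ near ne → drop (near-a₃ near) ne) c′-a₃
        (subst (λ cs → count x₁ cs ≤ 1) (sym colours-a₃) few₃)
        (λ w ne → Sum.map₂ (λ ne′ → ne , ne′) (same-or-not a₃ w)) acyclic-old)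
    ... | inj₂ (few₂ , few₃) =
      attach a₃ (a₂ ∷ a₀ ∷ b₃ ∷ c₃ ∷ []) (λ near _ → near-a₃ near) c′-a₃
        (subst (λ cs → count x₁ cs ≤ 1) (sym (cong₂ _∷_ c′-a₂ colours-a₃)) few₃) (λ w _ → same-or-not a₃ w)
      (attach a₂ (a₁ ∷ b₂ ∷ c₂ ∷ []) (λ near ne → drop (near-a₂ near) ne) c′-a₂
        (subst (λ cs → count x₂ cs ≤ 1) (sym colours-a₂) few₂)
        (λ w ne → Sum.map₂ (λ ne′ → ne′ , ne) (same-or-not a₂ w)) acyclic-old)

    -- Six vertices have greedy positions from `s` on: `s` to `s + 4`, and `s + 6`. Position `s + 5`
    -- is vacant, since it belongs to the copy that would come next.
    s : ℕ
    s = 6 + q * 12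

    six : List (V G)
    six = a₀ ∷ a₁ ∷ b₃ ∷ b₂ ∷ a₃ ∷ a₂ ∷ []

    p-at : ∀ {v t i} → place v ≡ (t , i) → p v ≡ pos t i
    p-at refl = refl

    below-s : ∀ {v t i n} → place v ≡ (t , i) → pos t i ≡ q * 12 + n → n < 6 → p v < s
    below-s pl eq lt = ≤-<-trans (≤-reflexive (trans (p-at pl) eq))
      (<-≤-trans (+-monoʳ-< (q * 12) lt) (≤-reflexive (+-comm (q * 12) 6)))

    above-s : ∀ {v t i n} → place v ≡ (t , i) → pos t i ≡ q * 12 + n → 6 ≤ n → s ≤ p v
    above-s pl eq le = ≤-trans (≤-trans (≤-reflexive (+-comm 6 (q * 12))) (+-monoʳ-≤ (q * 12) le))
      (≤-reflexive (sym (trans (p-at pl) eq)))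

    last-six : ∀ v → s ≤ p v → v ∈ six
    last-six v s≤ with place v in eq
    ... | t , i with t ≟ T₂ | t ≟ T₁
    last-six v s≤ | _ , 0F | yes refl | _ = here (vertex-unique 0F T₂< eq)
    last-six v s≤ | _ , 1F | yes refl | _ = there (here (vertex-unique 1F T₂< eq))
    last-six v s≤ | _ , 2F | yes refl | _ =
      there (there (there (there (there (here (vertex-unique 2F T₂< eq))))))
    last-six v s≤ | _ , 3F | yes refl | _ = there (there (there (there (here (vertex-unique 3F T₂< eq)))))
    last-six v s≤ | _ , 2F | no _ | yes refl = there (there (there (here (vertex-unique 2F T₁< eq))))
    last-six v s≤ | _ , 3F | no _ | yes refl = there (there (here (vertex-unique 3F T₁< eq)))
    last-six v s≤ | _ , 0F | no _ | yes refl =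
      contradiction (below-s eq (pos-m q 0F) (n<1+n 5)) (≤⇒≯ (≤-trans s≤ (≤-reflexive (sym (p-at eq)))))
    last-six v s≤ | _ , 1F | no _ | yes refl =
      contradiction (below-s eq (pos-m q 1F) (s≤s (n≤1+n 4))) (≤⇒≯ (≤-trans s≤ (≤-reflexive (sym (p-at eq)))))
    -- Copies up to `q * 3` reach at most position `4 + q * 12`, still below `s`.
    last-six v s≤ | t , i | no ne₂ | no ne₁ = contradiction s≤ (<⇒≱ (begin-strict
      pos t i            ≤⟨ bound-pos t i ⟩
      4 + t * 4          ≤⟨ +-monoʳ-≤ 4 (*-monoˡ-≤ 4 t≤) ⟩
      4 + q * 3 * 4      ≡⟨ cong (4 +_) (*-assoc q 3 4) ⟩
      4 + q * 12         <⟨ s≤s (s≤s (s≤s (s≤s (n<1+n _)))) ⟩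
      5 + q * 12         <⟨ n<1+n _ ⟩
      s                  ∎))
      where
      open ≤-Reasoning
      bound-pos = TripleBound.bound
      t≤ : t ≤ q * 3
      t≤ = s≤s⁻¹ (≤∧≢⇒< (s≤s⁻¹ (≤∧≢⇒< (s≤s⁻¹ (subst (_< suc q * 3) (cong proj₁ eq) (bounded v))) ne₂)) ne₁)

    -- Below `s` the colouring is unchanged and uses a colour at most once per block. The last six
    -- vertices raise the bound by 2, and by `balanced` they carry a colour at most twice.
    balanced′ : IsEquitable G 3 c′
    balanced′ a = begin
      length F                                             ≡⟨ length-filter-∁ low? F ⟩
      length (filter low? F) + length (filter (¬? ∘ low?) F) ≤⟨ +-mono-≤ low high ⟩
      ⌈ s / 3 ⌉ + 2                                        ≡⟨ +-comm ⌈ s / 3 ⌉ 2 ⟩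
      2 + (s + 2) / 3                                      ≡⟨ shift-/ 3 2 (s + 2) ⟨
      ⌈ 6 + s / 3 ⌉                                        ≡⟨ cong ⌈_/ 3 ⌉ (trans size N≡) ⟨
      ⌈ length (vertices G) / 3 ⌉                          ∎
      where
      open ≤-Reasoning
      N≡ : suc q * 3 * 4 ≡ 6 + s
      N≡ = cong (12 +_) (*-assoc q 3 4)
      has? = λ v → c′ v ≟ a
      low? = λ v → p v <? s
      F = filter has? (vertices G)
      F-unique = Unique.filter⁺ has? unique
      a₂-high : s ≤ p a₂
      a₂-high = above-s (at 2F T₂<) (pos-l q 2F) (m≤m+n 6 2)
      a₃-high : s ≤ p a₃
      a₃-high = above-s (at 3F T₂<) (pos-l q 3F) (m≤m+n 6 6)
      coloured : ∀ {v} → v ∈ F → c′ v ≡ a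
      coloured v∈ = proj₂ (∈-filter⁻ has? {xs = vertices G} v∈)
      low : length (filter low? F) ≤ ⌈ s / 3 ⌉
      low = class-bound fine s (Unique.filter⁺ low? F-unique) (All.tabulate λ {v} v∈ →
        let (v∈F , v<s) = ∈-filter⁻ low? {xs = F} v∈ in
        trans (sym (c′-old (λ { refl → <⇒≱ v<s a₂-high }) (λ { refl → <⇒≱ v<s a₃-high }))) (coloured v∈F) , v<s)
      high : length (filter (¬? ∘ low?) F) ≤ 2
      high = begin
        length (filter (¬? ∘ low?) F)  ≤⟨ Unique-⊆⇒length-≤ (Unique.filter⁺ (¬? ∘ low?) F-unique) (λ {v} v∈ →
                                           let (v∈F , v≮s) = ∈-filter⁻ (¬? ∘ low?) {xs = F} v∈ in
                                           ∈-filter⁺ has? (last-six v (≮⇒≥ v≮s)) (coloured v∈F)) ⟩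
        length (filter has? six)       ≡⟨ length-filter-map c′ a six ⟩
        count a (map c′ six)           ≡⟨ cong (count a) (cong₂ _∷_ old-a₀ (cong₂ _∷_ old-a₁ (cong₂ _∷_ old-b₃
                                            (cong₂ _∷_ old-b₂ (cong₂ _∷_ c′-a₃ (cong (_∷ []) c′-a₂)))))) ⟩
        _                              ≤⟨ balanced a ⟩
        2                              ∎

    recoloured : ∃ λ c → IsLColouring G L c × IsEquitable G 3 c × (∀ a → ClassAcyclic G c a)
    recoloured = c′ , listed′ , balanced′ ,
      λ a cyc isC → acyclic′ cyc isC (All.tabulate λ {v} _ → p<bound v) a

  solution : ∃ λ c → IsLColouring G L c × IsEquitable G 3 c × (∀ a → ClassAcyclic G c a)
  solution = let (C , fine) = colouring in Recoloured.recoloured fine (rung fine)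

-- The linear order of the copies

length-cartesianProduct : ∀ {A B : Set} (xs : List A) (ys : List B) →
  length (cartesianProduct xs ys) ≡ length xs * length ys
length-cartesianProduct [] ys = refl
length-cartesianProduct (x ∷ xs) ys = trans (length-++ (map (x ,_) ys))
  (cong₂ _+_ (length-map (x ,_) ys) (length-cartesianProduct xs ys))

-- The copies of the 4-cycle are ordered row by row, the last row backwards. So the last copy lies above the
-- first copy of the row before, and D of its index is divisible by 3 whenever the width w is.

module RowOrder (n w : ℕ) where

  M : ℕ
  M = (n ∸ 1) * w

  -- Before the last row the copy above is `w` steps back; in the last row, which runs backwards, it
  -- is the mirror image of `t` in the boundary at `M`. In the first row the value is just 0; an
  -- `Edge` without a counterpart in the graph does no harm.
  D : ℕ → ℕ
  D t with t <? M
  ... | yes _ = t ∸ w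
  ... | no _  = M + M ∸ suc t

  D-low : ∀ {t} → t < M → D t ≡ t ∸ w
  D-low {t} lt with t <? M
  ... | yes _ = refl
  ... | no ¬lt = contradiction lt ¬lt

  D-high : ∀ {t} → M ≤ t → D t ≡ M + M ∸ suc t
  D-high {t} le with t <? M
  ... | yes lt = contradiction le (<⇒≱ lt)
  ... | no _ = refl

  Last : Fin n → Set
  Last i = suc (toℕ i) ≡ n

  turn : Fin n → Fin w → Fin w
  turn i j with suc (toℕ i) ≟ n
  ... | yes _ = opposite j
  ... | no _  = j

  turn-other : ∀ {i} j → ¬ Last i → turn i j ≡ j
  turn-other {i} j ¬last with suc (toℕ i) ≟ n
  ... | yes last = contradiction last ¬last
  ... | no _     = refl

  turn-involutive : ∀ i j → turn i (turn i j) ≡ j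
  turn-involutive i j with suc (toℕ i) ≟ n
  ... | yes _ = opposite-involutive j
  ... | no _  = refl

  index : Fin n × Fin w → ℕ
  index (i , j) = toℕ (combine i (turn i j))

  index≡ : ∀ i j → index (i , j) ≡ w * toℕ i + toℕ (turn i j)
  index≡ i j = toℕ-combine i (turn i j)

  index< : ∀ x → index x < n * w
  index< (i , j) = toℕ<n (combine i (turn i j))

  index-injective : ∀ {x y} → index x ≡ index y → x ≡ y
  index-injective {i , j} {i′ , j′} eq with combine-injective i (turn i j) i′ (turn i′ j′) (toℕ-injective eq)
  ... | refl , turn≡ = cong (i ,_)
    (trans (sym (turn-involutive i j)) (trans (cong (turn i) turn≡) (turn-involutive i j′)))

  index-surjective : ∀ {t} → t < n * w → ∃ λ x → index x ≡ t
  index-surjective {t} lt with combine-surjective {n} {w} (fromℕ< lt)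
  ... | i , j , eq = (i , turn i j) ,
    trans (cong (toℕ ∘ combine i) (turn-involutive i j)) (trans (cong toℕ eq) (toℕ-fromℕ< lt))

  Next : ℕ → ℕ → Set
  Next s t = suc s ≡ t ⊎ (s ≡ D t × D t < t)

  -- The two ends swap roles in the last row because it runs backwards.
  row-next : ∀ i {j j′} → toℕ j′ ≡ suc (toℕ j) →
             Next (index (i , j)) (index (i , j′)) ⊎ Next (index (i , j′)) (index (i , j))
  row-next i {j} {j′} eq with suc (toℕ i) ≟ n
  ... | no _ = inj₁ (inj₁ (sym (begin
    toℕ (combine i j′)          ≡⟨ toℕ-combine i j′ ⟩
    w * toℕ i + toℕ j′          ≡⟨ cong (w * toℕ i +_) eq ⟩
    w * toℕ i + suc (toℕ j)     ≡⟨ +-suc (w * toℕ i) (toℕ j) ⟩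
    suc (w * toℕ i + toℕ j)     ≡⟨ cong suc (toℕ-combine i j) ⟨
    suc (toℕ (combine i j))     ∎)))
    where open ≡-Reasoning
  ... | yes _ = inj₂ (inj₁ (begin
    suc (toℕ (combine i (opposite j′)))     ≡⟨ cong suc (toℕ-combine i (opposite j′)) ⟩
    suc (w * toℕ i + toℕ (opposite j′))     ≡⟨ +-suc (w * toℕ i) (toℕ (opposite j′)) ⟨
    w * toℕ i + suc (toℕ (opposite j′))     ≡⟨ cong (w * toℕ i +_) opp ⟩
    w * toℕ i + toℕ (opposite j)            ≡⟨ toℕ-combine i (opposite j) ⟨
    toℕ (combine i (opposite j))            ∎))
    where
    open ≡-Reasoning
    opp : suc (toℕ (opposite j′)) ≡ toℕ (opposite j)
    opp = begin
      suc (toℕ (opposite j′))     ≡⟨ cong suc (opposite-prop j′) ⟩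
      suc (w ∸ suc (toℕ j′))      ≡⟨ +-∸-assoc 1 (toℕ<n j′) ⟨
      w ∸ toℕ j′                  ≡⟨ cong (w ∸_) eq ⟩
      w ∸ suc (toℕ j)             ≡⟨ opposite-prop j ⟨
      toℕ (opposite j)            ∎

  column-next : ∀ {i i′} j → toℕ i′ ≡ suc (toℕ i) → Next (index (i , j)) (index (i′ , j))
  column-next {i} {i′} j eq = inj₂ (sym D≡ , subst (_< index (i′ , j)) (sym D≡) lower)
    where
    open ≤-Reasoning
    a = w * toℕ i
    ¬last : ¬ Last i
    ¬last last = <⇒≢ (toℕ<n i′) (trans eq last)
    index-i : index (i , j) ≡ a + toℕ j
    index-i = trans (index≡ i j) (cong (λ x → a + toℕ x) (turn-other j ¬last))
    index-i′ : index (i′ , j) ≡ a + w + toℕ (turn i′ j)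
    index-i′ = trans (index≡ i′ j) (cong (_+ toℕ (turn i′ j))
      (trans (cong (w *_) eq) (trans (*-suc w (toℕ i)) (+-comm w a))))
    lower : index (i , j) < index (i′ , j)
    lower = begin-strict
      index (i , j)                 ≡⟨ index-i ⟩
      a + toℕ j                     <⟨ +-monoʳ-< a (toℕ<n j) ⟩
      a + w                         ≤⟨ m≤m+n (a + w) _ ⟩
      a + w + toℕ (turn i′ j)       ≡⟨ index-i′ ⟨
      index (i′ , j)                ∎
    D≡ : D (index (i′ , j)) ≡ index (i , j)
    D≡ with suc (toℕ i′) ≟ n
    -- Here `M` is `a + w`, and reflecting the index in `M` undoes `opposite`.
    ... | yes last = begin-equality
      D (toℕ (combine i′ (opposite j)))  ≡⟨ D-high (begin
                                              M       ≡⟨ M≡ ⟩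
                                              a + w   ≤⟨ m≤m+n (a + w) _ ⟩
                                              _       ≡⟨ index-o ⟨
                                              _       ∎) ⟩
      M + M ∸ suc (toℕ (combine i′ (opposite j)))
        ≡⟨ cong₂ (λ x y → x + x ∸ suc y) M≡ index-o ⟩
      (a + w) + (a + w) ∸ suc (a + w + toℕ (opposite j))
        ≡⟨ cong ((a + w) + (a + w) ∸_) (+-suc (a + w) _) ⟨
      (a + w) + (a + w) ∸ (a + w + suc (toℕ (opposite j)))
        ≡⟨ [m+n]∸[m+o]≡n∸o (a + w) (a + w) _ ⟩
      a + w ∸ suc (toℕ (opposite j))
        ≡⟨ +-∸-assoc a (toℕ<n (opposite j)) ⟩
      a + (w ∸ suc (toℕ (opposite j)))
        ≡⟨ cong (a +_) (trans (sym (opposite-prop (opposite j))) (cong toℕ (opposite-involutive j))) ⟩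
      a + toℕ j                          ≡⟨ index-i ⟨
      index (i , j)                      ∎
      where
      M≡ : M ≡ a + w
      M≡ = trans (cong (λ m → (m ∸ 1) * w) (sym last))
        (trans (*-comm (toℕ i′) w) (trans (cong (w *_) eq) (trans (*-suc w (toℕ i)) (+-comm w a))))
      index-o : toℕ (combine i′ (opposite j)) ≡ a + w + toℕ (opposite j)
      index-o = trans (toℕ-combine i′ (opposite j)) (cong (_+ toℕ (opposite j))
        (trans (cong (w *_) eq) (trans (*-suc w (toℕ i)) (+-comm w a))))
    ... | no ¬last′ = begin-equality
      D (toℕ (combine i′ j))   ≡⟨ D-low (begin-strict
                                    toℕ (combine i′ j)    ≡⟨ toℕ-combine i′ j ⟩
                                    w * toℕ i′ + toℕ j    <⟨ +-monoʳ-< (w * toℕ i′) (toℕ<n j) ⟩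
                                    w * toℕ i′ + w        ≡⟨ trans (+-comm _ w) (sym (*-suc w (toℕ i′))) ⟩
                                    w * suc (toℕ i′)      ≤⟨ *-monoʳ-≤ w (∸-monoˡ-≤ 1 (≤∧≢⇒< (toℕ<n i′) ¬last′)) ⟩
                                    w * (n ∸ 1)           ≡⟨ *-comm w (n ∸ 1) ⟩
                                    M                     ∎) ⟩
      toℕ (combine i′ j) ∸ w   ≡⟨ cong (_∸ w) (trans (toℕ-combine i′ j) (cong (λ x → w * x + toℕ j) eq)) ⟩
      w * suc (toℕ i) + toℕ j ∸ w   ≡⟨ cong (λ x → x + toℕ j ∸ w) (*-suc w (toℕ i)) ⟩
      w + a + toℕ j ∸ w        ≡⟨ cong (_∸ w) (+-assoc w a (toℕ j)) ⟩
      w + (a + toℕ j) ∸ w      ≡⟨ m+n∸m≡n w (a + toℕ j) ⟩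
      a + toℕ j                ≡⟨ index-i ⟨
      index (i , j)            ∎

  index-adjacent : ∀ {x y} → Adj (P n □ P w) x y → Next (index x) (index y) ⊎ Next (index y) (index x)
  index-adjacent {i , j} {.i , j′} (inj₁ (refl , inj₁ eq)) = row-next i eq
  index-adjacent {i , j} {.i , j′} (inj₁ (refl , inj₂ eq)) = Sum.swap (row-next i eq)
  index-adjacent {i , j} {i′ , .j} (inj₂ (inj₁ eq , refl)) = inj₁ (column-next j eq)
  index-adjacent {i , j} {i′ , .j} (inj₂ (inj₂ eq , refl)) = inj₂ (column-next j eq)

-- The last copy is mirrored to the first copy of the row before, at `M` minus the width, and both
-- are multiples of 3. With a single row, truncated subtraction gives copy 0.
D-last : ∀ n w′ q → n * w′ ≡ suc q → ∃ λ e → e ≤ q × RowOrder.D n (w′ * 3) (2 + q * 3) ≡ e * 3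
D-last (suc n) zero q eq with () ← trans (sym (*-zeroʳ n)) eq
D-last (suc n) w′@(suc w″) q eq = n * w′ ∸ w′ , e≤ , (begin
  D (2 + q * 3)                       ≡⟨ D-high M≤ ⟩
  M + M ∸ suc q * 3                   ≡⟨ cong (λ x → M + M ∸ x * 3) (sym eq) ⟩
  M + M ∸ (w′ + n * w′) * 3           ≡⟨ cong (M + M ∸_) (trans (*-distribʳ-+ 3 w′ (n * w′))
                                           (trans (+-comm (w′ * 3) _) (cong (_+ w′ * 3) (*-assoc n w′ 3)))) ⟩
  M + M ∸ (M + w′ * 3)                ≡⟨ [m+n]∸[m+o]≡n∸o M M (w′ * 3) ⟩
  M ∸ w′ * 3                          ≡⟨ cong (_∸ w′ * 3) (sym (*-assoc n w′ 3)) ⟩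
  n * w′ * 3 ∸ w′ * 3                 ≡⟨ *-distribʳ-∸ 3 (n * w′) w′ ⟨
  (n * w′ ∸ w′) * 3                   ∎)
  where
  open ≡-Reasoning
  open RowOrder (suc n) (w′ * 3)
  nw≤q : n * w′ ≤ q
  nw≤q = ≤-trans (m≤n+m (n * w′) w″) (≤-reflexive (suc-injective eq))
  e≤ : n * w′ ∸ w′ ≤ q
  e≤ = ≤-trans (m∸n≤m (n * w′) w′) nw≤q
  M≤ : M ≤ 2 + q * 3
  M≤ = ≤-trans (≤-trans (≤-reflexive (sym (*-assoc n w′ 3))) (*-monoˡ-≤ 3 nw≤q)) (m≤n+m (q * 3) 2)

-- The product as a layout

-- A Gray code, so that cyclically consecutive corners are exactly the adjacent ones.
corner : Fin 2 × Fin 2 → Fin 4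
corner (0F , 0F) = 0F
corner (0F , 1F) = 1F
corner (1F , 1F) = 2F
corner (1F , 0F) = 3F

corner⁻¹ : Fin 4 → Fin 2 × Fin 2
corner⁻¹ 0F = 0F , 0F
corner⁻¹ 1F = 0F , 1F
corner⁻¹ 2F = 1F , 1F
corner⁻¹ 3F = 1F , 0F

corner⁻¹-corner : ∀ a → corner⁻¹ (corner a) ≡ a
corner⁻¹-corner (0F , 0F) = refl
corner⁻¹-corner (0F , 1F) = refl
corner⁻¹-corner (1F , 1F) = refl
corner⁻¹-corner (1F , 0F) = refl

corner-corner⁻¹ : ∀ i → corner (corner⁻¹ i) ≡ i
corner-corner⁻¹ 0F = refl
corner-corner⁻¹ 1F = refl
corner-corner⁻¹ 2F = refl
corner-corner⁻¹ 3F = refl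

corner-injective : ∀ {a b} → corner a ≡ corner b → a ≡ b
corner-injective {a} {b} eq = trans (sym (corner⁻¹-corner a)) (trans (cong corner⁻¹ eq) (corner⁻¹-corner b))

Consecutive : Fin 4 → Fin 4 → Set
Consecutive i i′ = next i ≡ i′ ⊎ next i′ ≡ i

corner-second : ∀ a b b′ → Adj (P 2) b b′ → Consecutive (corner (a , b)) (corner (a , b′))
corner-second 0F 0F 1F _ = inj₁ refl
corner-second 0F 1F 0F _ = inj₂ refl
corner-second 1F 0F 1F _ = inj₂ refl
corner-second 1F 1F 0F _ = inj₁ refl
corner-second _ 0F 0F (inj₁ ())
corner-second _ 0F 0F (inj₂ ())
corner-second _ 1F 1F (inj₁ ())
corner-second _ 1F 1F (inj₂ ())

corner-first : ∀ a a′ b → Adj (P 2) a a′ → Consecutive (corner (a , b)) (corner (a′ , b))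
corner-first 0F 1F 0F _ = inj₂ refl
corner-first 1F 0F 0F _ = inj₁ refl
corner-first 0F 1F 1F _ = inj₁ refl
corner-first 1F 0F 1F _ = inj₂ refl
corner-first 0F 0F _ (inj₁ ())
corner-first 0F 0F _ (inj₂ ())
corner-first 1F 1F _ (inj₁ ())
corner-first 1F 1F _ (inj₂ ())

module _ (n₃ n₄ n w : ℕ) (σ : Fin n₃ × Fin n₄ → Fin n × Fin w)
         (area : n₃ * n₄ ≡ n * w)
         (σ-injective : ∀ {x y} → σ x ≡ σ y → x ≡ y)
         (σ-surjective : ∀ y → ∃ λ x → σ x ≡ y)
         (σ-adjacent : ∀ {x y} → Adj (P n₃ □ P n₄) x y → Adj (P n □ P w) (σ x) (σ y)) where

  open RowOrder n w

  -- The map `σ` will be the identity or the exchange of the two long paths, so that either can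
  -- serve as the row.
  product-layout : Layout (P 2 □ P 2 □ P n₃ □ P n₄) (n * w) D
  product-layout = record
    { unique     = Unique.cartesianProduct⁺ (Unique.allFin⁺ 2) (Unique.cartesianProduct⁺ (Unique.allFin⁺ 2)
                     (Unique.cartesianProduct⁺ (Unique.allFin⁺ n₃) (Unique.allFin⁺ n₄)))
    ; complete   = λ (a , b , x , y) → ∈-cartesianProduct⁺ (∈-allFin a) (∈-cartesianProduct⁺ (∈-allFin b)
                     (∈-cartesianProduct⁺ (∈-allFin x) (∈-allFin y)))
    ; size       = size
    ; place      = place
    ; injective  = λ {u} {v} → injective u v
    ; bounded    = λ (_ , _ , x) → index< (σ x)
    ; surjective = surjective
    ; adjacent   = λ {u} {v} → adjacent u v
    }
    where
    G = P 2 □ P 2 □ P n₃ □ P n₄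

    place : V G → Place
    place (a , b , x) = index (σ x) , corner (a , b)

    size : length (vertices G) ≡ n * w * 4
    size = begin
      length (vertices G)
        ≡⟨ length-cartesianProduct (allFin 2) (vertices (P 2 □ P n₃ □ P n₄)) ⟩
      2 * length (cartesianProduct (allFin 2) (cartesianProduct (allFin n₃) (allFin n₄)))
        ≡⟨ cong (2 *_) (length-cartesianProduct (allFin 2) (vertices (P n₃ □ P n₄))) ⟩
      2 * (2 * length (cartesianProduct (allFin n₃) (allFin n₄)))
        ≡⟨ cong (λ m → 2 * (2 * m)) (length-cartesianProduct (allFin n₃) (allFin n₄)) ⟩
      2 * (2 * (length (allFin n₃) * length (allFin n₄)))
        ≡⟨ cong₂ (λ x y → 2 * (2 * (x * y))) (length-tabulate {n = n₃} (λ i → i)) (length-tabulate {n = n₄} (λ i → i)) ⟩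
      2 * (2 * (n₃ * n₄))
        ≡⟨ *-assoc 2 2 (n₃ * n₄) ⟨
      4 * (n₃ * n₄)
        ≡⟨ trans (*-comm 4 (n₃ * n₄)) (cong (_* 4) area) ⟩
      n * w * 4 ∎
      where open ≡-Reasoning

    injective : ∀ u v → place u ≡ place v → u ≡ v
    injective (a , b , x) (a′ , b′ , x′) eq
      with corner-injective {a , b} {a′ , b′} (cong proj₂ eq) | σ-injective (index-injective (cong proj₁ eq))
    ... | refl | refl = refl

    surjective : ∀ {t} i → t < n * w → ∃ λ v → place v ≡ (t , i)
    surjective i lt with index-surjective lt
    ... | y , index-y with σ-surjective y
    ...   | x , σx = (proj₁ (corner⁻¹ i) , proj₂ (corner⁻¹ i) , x) ,
      cong₂ _,_ (trans (cong index σx) index-y) (corner-corner⁻¹ i)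

    next-edge : ∀ {s t} i → Next s t → Edge D (s , i) (t , i)
    next-edge i (inj₁ refl)        = step _ i
    next-edge i (inj₂ (refl , lt)) = down i lt

    ring-edge : ∀ t {i i′} → Consecutive i i′ → Edge D (t , i) (t , i′) ⊎ Edge D (t , i′) (t , i)
    ring-edge t (inj₁ refl) = inj₁ (ring t _)
    ring-edge t (inj₂ refl) = inj₂ (ring t _)

    adjacent : ∀ u v → Adj G u v → Edge D (place u) (place v) ⊎ Edge D (place v) (place u)
    adjacent (a , b , x) (.a , .b , x′) (inj₁ (refl , inj₁ (refl , adj))) =
      Sum.map (next-edge _) (next-edge _) (index-adjacent (σ-adjacent adj))
    adjacent (a , b , x) (.a , b′ , .x) (inj₁ (refl , inj₂ (adj , refl))) =
      ring-edge _ (corner-second a b b′ adj)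
    adjacent (a , b , x) (a′ , .b , .x) (inj₂ (adj , refl)) = ring-edge _ (corner-first a a′ b adj)

layout : ∀ n₃ n₄ → Layout (P 2 □ P 2 □ P n₃ □ P n₄) (n₃ * n₄) (RowOrder.D n₃ n₄)
layout n₃ n₄ = product-layout n₃ n₄ n₃ n₄ (λ x → x) refl (λ eq → eq) (λ y → y , refl) (λ adj → adj)

layout-swapped : ∀ n₃ n₄ → Layout (P 2 □ P 2 □ P n₃ □ P n₄) (n₄ * n₃) (RowOrder.D n₄ n₃)
layout-swapped n₃ n₄ = product-layout n₃ n₄ n₄ n₃ swap (*-comm n₃ n₄) (cong swap) (λ y → swap y , refl) adj
  where
  adj : ∀ {x y} → Adj (P n₃ □ P n₄) x y → Adj (P n₄ □ P n₃) (swap x) (swap y)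
  adj (inj₁ (eq , a)) = inj₂ (a , eq)
  adj (inj₂ (a , eq)) = inj₁ (eq , a)

-- The cases of the theorem

three-divides : ∀ {G} n w′ → Layout G (n * (w′ * 3)) (RowOrder.D n (w′ * 3)) → EquitablyListArborable G 3
three-divides {G} n w′ lay with n * w′ in eq
-- There are no copies, and the graph is empty.
... | zero = scheduled⇒arborable lay Triples.schedule λ {t} i lt →
  contradiction (subst (t <_) (trans (sym (*-assoc n w′ 3)) (cong (_* 3) eq)) lt) λ ()
... | suc q with D-last n w′ q eq
...   | e , e≤q , D≡ = λ L uniform → LastLadder.solution lay′ e≤q D≡ L uniform
  where
  lay′ : Layout G (suc q * 3) (RowOrder.D n (w′ * 3))
  lay′ = subst (λ N → Layout G N (RowOrder.D n (w′ * 3))) (trans (sym (*-assoc n w′ 3)) (cong (_* 3) eq)) lay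

three-not-divides : ∀ {G N D} → Layout G N D → N % 3 ≢ 0 → EquitablyListArborable G 3
three-not-divides {N = N} lay ne with N % 3 | m≡m%n+[m/n]*n N 3 | m%n<n N 3
... | 0 | _    | _ = contradiction refl ne
... | 1 | eq   | _ = scheduled⇒arborable (subst (λ N → Layout _ N _) eq lay) Triples.schedule
  (inside-below Triples.pos _ TripleBound.near (TripleBound.top₁ (N / 3)))
... | 2 | eq   | _ = scheduled⇒arborable (subst (λ N → Layout _ N _) eq lay) Triples.schedule
  (inside-below Triples.pos _ TripleBound.near (TripleBound.top₂ (N / 3)))
... | suc (suc (suc _)) | _ | s≤s (s≤s (s≤s ()))

four : ∀ {G N D} → Layout G N D → EquitablyListArborable G 4
four {N = N} lay with N % 2 | m≡m%n+[m/n]*n N 2 | m%n<n N 2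
... | 0 | eq | _ = even (N / 2) (subst (λ N → Layout _ N _) eq lay)
  where
  even : ∀ {G D} q → Layout G (q * 2) D → EquitablyListArborable G 4
  even zero    lay = scheduled⇒arborable lay EvenPairs.schedule λ _ ()
  even (suc q) lay = scheduled⇒arborable lay EvenPairs.schedule
    (inside-below EvenPairs.pos _ EvenBound.near (EvenBound.top q))
... | 1 | eq | _ = scheduled⇒arborable (subst (λ N → Layout _ N _) eq lay) OddPairs.schedule
  (inside-below OddPairs.pos _ OddBound.near (OddBound.top (N / 2)))
... | suc (suc _) | _ | s≤s (s≤s ())

theorem11 : (n₃ n₄ k : ℕ) → k ≥ 3 →
    EquitablyListArborable (P 2 □ P 2 □ P n₃ □ P n₄) k
theorem11 n₃ n₄ 3 _ with n₃ * n₄ % 3 ≟ 0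
... | no ne = three-not-divides (layout n₃ n₄) ne
-- As 3 is prime, it divides one of the two lengths, and that path is laid along the rows.
... | yes eq with euclidsLemma n₃ n₄ (toWitness {a? = prime? 3} _) (m%n≡0⇒n∣m (n₃ * n₄) 3 eq)
...   | inj₁ (divides w′ refl) = three-divides n₄ w′ (layout-swapped n₃ n₄)
...   | inj₂ (divides w′ refl) = three-divides n₃ w′ (layout n₃ n₄)
theorem11 n₃ n₄ 4 _ = four (layout n₃ n₄)
theorem11 n₃ n₄ (suc (suc (suc (suc (suc j))))) _ =
  scheduled⇒arborable (layout n₃ n₄) (Lexicographic.schedule j) (Lexicographic.inside j)
theorem11 _ _ 1 (s≤s ())
theorem11 _ _ 2 (s≤s (s≤s ()))
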